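{- For any NC-path-tree graph $G$, there is an independent dominating set of $G$ that is also a minimum dominating set of $G$. Moreover, such an independent dominating set can be found in linear time.
   Context: All graphs are finite, simple, loopless, undirected and connected. For a graph with $n$ vertices and $m$ edges, linear time means $O(n+m)$. A path-tree model of $G$ is a pair $(\{P_v\}_{v\in V(G)},T)$ where each $P_v$ is a path (possibly a single node), $T=\bigcup_{v}P_v$ is a tree, and for distinct $u,v$, $uv\in E(G)$ if and only if $P_u$ and $P_v$ share a node. Two paths $P_u,P_v$ are non-crossing if both $P_u\setminus P_v$ and $P_v\setminus P_u$ (obtained by deleting the nodes of the other path) are connected, where the empty set counts as connected. $G$ is an NC-path-tree graph if it has a path-tree model whose paths are pairwise non-crossing. A dominating set of $G$ is a set $D\subseteq V(G)$ such that every vertex is in $D$ or adjacent to a vertex of $D$; it is minimum if it has the fewest vertices among all dominating sets, and independent if $G[D]$ has no edges. -}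

module Defs where

open import Data.Bool.Base using (Bool; true; false; if_then_else_; not; T)
open import Data.Bool.Properties using (T?)
open import Data.Fin.Base using (Fin; toℕ)
import Data.Fin.Properties as Fin
open import Data.Fin.Subset using (Subset; _∈_; ∣_∣)
open import Data.List.Base
  using (List; []; _∷_; _++_; [_]; allFin; cartesianProduct; concat; drop; filter; head; length; map; take)
open import Data.List.Membership.Propositional using () renaming (_∈_ to _∈ₗ_; _∉_ to _∉ₗ_)
open import Data.List.Relation.Unary.Linked using (Linked)
open import Data.List.Relation.Unary.Unique.Propositional using (Unique)
open import Data.Maybe.Base using (fromMaybe)
open import Data.Nat.Base using (ℕ; zero; suc; pred; _+_; _*_; _≤_; _≡ᵇ_; _<ᵇ_)
open import Data.Product.Base using (Σ; ∃; ∃-syntax; _×_; _,_)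
open import Data.Sum.Base using (_⊎_)
open import Data.Vec.Base using (tabulate)
open import Function.Bundles using (_⇔_)
open import Function.Base using (_∘_)
open import Relation.Binary.Construct.Closure.ReflexiveTransitive using (Star)
open import Relation.Binary.PropositionalEquality using (_≡_; _≢_)
open import Relation.Nullary.Decidable using (_×-dec_)
open import Relation.Nullary.Negation using (¬_)

record Graph (n : ℕ) : Set where
  field
    adj     : Fin n → Fin n → Bool
    adj-sym : ∀ u v → adj u v ≡ adj v u
    no-loop : ∀ v → adj v v ≡ false

Edge : ∀ {n} → Graph n → Fin n → Fin n → Set
Edge G u v = T (Graph.adj G u v)

edgeCount : ∀ {n} → Graph n → ℕ
edgeCount {n} G =
  length (filter (λ (u , v) → (u Fin.<? v) ×-dec T? (Graph.adj G u v))
                 (cartesianProduct (allFin n) (allFin n)))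

-- The graph without vertices does not count as connected.
Connected : ∀ {n} → Graph n → Set
Connected {n} G = Fin n × (∀ u v → Star (Edge G) u v)

Acyclic : ∀ {n} → Graph n → Set
Acyclic {n} G = ∀ (v : Fin n) (vs : List (Fin n)) → 2 ≤ length vs →
                Unique (v ∷ vs) → ¬ Linked (Edge G) (v ∷ vs ++ [ v ])

IsTree : ∀ {n} → Graph n → Set
IsTree G = Connected G × Acyclic G

record Path {k} (H : Graph k) : Set where
  field
    nodes    : List (Fin k)
    nonempty : nodes ≢ []
    distinct : Unique nodes
    linked   : Linked (Edge H) nodes

open Path public using (nodes)

Consecutive : {A : Set} → List A → A → A → Set
Consecutive zs x y = ∃[ xs ] ∃[ ys ] zs ≡ xs ++ x ∷ y ∷ ys

PathEdge : ∀ {k} {H : Graph k} → Path H → Fin k → Fin k → Set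
PathEdge P x y = Consecutive (nodes P) x y ⊎ Consecutive (nodes P) y x

record PathTreeModel {n} (G : Graph n) : Set where
  field
    size         : ℕ
    tree         : Graph size
    isTree       : IsTree tree
    path         : Fin n → Path tree
    -- The tree is the union, as a graph, of the paths.
    nodesCovered : ∀ x → ∃[ v ] x ∈ₗ nodes (path v)
    edgesCovered : ∀ x y → Edge tree x y → ∃[ v ] PathEdge (path v) x y
    intersection : ∀ u v → u ≢ v →
                   Edge G u v ⇔ (∃[ x ] x ∈ₗ nodes (path u) × x ∈ₗ nodes (path v))

module _ {k} {H : Graph k} where

  _∈_∖_ : Fin k → Path H → Path H → Set
  x ∈ P ∖ Q = x ∈ₗ nodes P × x ∉ₗ nodes Q

  DifferenceConnected : Path H → Path H → Set
  DifferenceConnected P Q = ∀ x y → x ∈ P ∖ Q → y ∈ P ∖ Q →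
    Star (λ a b → a ∈ P ∖ Q × b ∈ P ∖ Q × PathEdge P a b) x y

  NonCrossing : Path H → Path H → Set
  NonCrossing P Q = DifferenceConnected P Q × DifferenceConnected Q P

IsNCPathTree : ∀ {n} → Graph n → Set
IsNCPathTree G = Σ (PathTreeModel G) λ M → let open PathTreeModel M in
                 ∀ u v → u ≢ v → NonCrossing (path u) (path v)

module _ {n} (G : Graph n) where

  Dominating : Subset n → Set
  Dominating D = ∀ v → v ∈ D ⊎ (∃[ u ] u ∈ D × Edge G v u)

  MinimumDominating : Subset n → Set
  MinimumDominating D = Dominating D × (∀ D′ → Dominating D′ → ∣ D ∣ ≤ ∣ D′ ∣)

  Independent : Subset n → Set
  Independent D = ∀ u v → u ∈ D → v ∈ D → ¬ Edge G u v

  IndependentMinimumDominating : Subset n → Set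
  IndependentMinimumDominating D = Independent D × MinimumDominating D

-- A unit-cost random access machine, as a while-language over numeric
-- variables and arrays.  A program mentions finitely many names.
-- Arithmetic is limited to successor and predecessor: stored values then
-- exceed the largest input value or program constant by at most the
-- running time, so charging one unit per operation is not exploitable by
-- packing data into huge numbers.

data Expr : Set where
  lit   : ℕ → Expr
  var   : ℕ → Expr
  _⟦_⟧  : ℕ → Expr → Expr      -- array name, index
  suc1  : Expr → Expr
  pred1 : Expr → Expr

data Test : Set where
  _≺_ _≐_ : Expr → Expr → Test

data Cmd : Set where
  skip          : Cmd
  _≔_           : ℕ → Expr → Cmd
  _⟦_⟧≔_        : ℕ → Expr → Expr → Cmd
  _⨾_           : Cmd → Cmd → Cmd
  IF_THEN_ELSE_ : Test → Cmd → Cmd → Cmd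
  WHILE_DO_     : Test → Cmd → Cmd

infixr 4 _⨾_
infix  5 _≔_ _⟦_⟧≔_ IF_THEN_ELSE_ WHILE_DO_
infix  6 _≺_ _≐_
infix  7 _⟦_⟧

record Store : Set where
  constructor store
  field
    vars   : ℕ → ℕ
    arrays : ℕ → ℕ → ℕ

open Store public

update : {A : Set} → (ℕ → A) → ℕ → A → ℕ → A
update f i a j = if i ≡ᵇ j then a else f j

setVar : Store → ℕ → ℕ → Store
setVar s x k = store (update (vars s) x k) (arrays s)

setCell : Store → ℕ → ℕ → ℕ → Store
setCell s a i k = store (vars s) (update (arrays s) a (update (arrays s a) i k))

eval : Expr → Store → ℕ
eval (lit k)   s = k
eval (var x)   s = vars s x
eval (a ⟦ e ⟧) s = arrays s a (eval e s)
eval (suc1 e)  s = suc (eval e s)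
eval (pred1 e) s = pred (eval e s)

test : Test → Store → Bool
test (e ≺ f) s = eval e s <ᵇ eval f s
test (e ≐ f) s = eval e s ≡ᵇ eval f s

exprCost : Expr → ℕ
exprCost (lit _)   = 1
exprCost (var _)   = 1
exprCost (_ ⟦ e ⟧) = suc (exprCost e)
exprCost (suc1 e)  = suc (exprCost e)
exprCost (pred1 e) = suc (exprCost e)

testCost : Test → ℕ
testCost (e ≺ f) = suc (exprCost e + exprCost f)
testCost (e ≐ f) = suc (exprCost e + exprCost f)

-- ⟨ c , s ⟩⇓[ t ] s′ : started in s, the program c halts in s′ after t steps.
data ⟨_,_⟩⇓[_]_ : Cmd → Store → ℕ → Store → Set where

  run-skip : ∀ {s} → ⟨ skip , s ⟩⇓[ 1 ] s

  run-assign : ∀ {x e s} →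
    ⟨ x ≔ e , s ⟩⇓[ suc (exprCost e) ] setVar s x (eval e s)

  run-write : ∀ {a i e s} →
    ⟨ a ⟦ i ⟧≔ e , s ⟩⇓[ suc (exprCost i + exprCost e) ]
      setCell s a (eval i s) (eval e s)

  run-seq : ∀ {c d s s′ s″ t t′} →
    ⟨ c , s ⟩⇓[ t ] s′ → ⟨ d , s′ ⟩⇓[ t′ ] s″ →
    ⟨ c ⨾ d , s ⟩⇓[ t + t′ ] s″

  run-then : ∀ {b c d s s′ t} → test b s ≡ true → ⟨ c , s ⟩⇓[ t ] s′ →
    ⟨ IF b THEN c ELSE d , s ⟩⇓[ testCost b + t ] s′

  run-else : ∀ {b c d s s′ t} → test b s ≡ false → ⟨ d , s ⟩⇓[ t ] s′ →
    ⟨ IF b THEN c ELSE d , s ⟩⇓[ testCost b + t ] s′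

  run-stop : ∀ {b c s} → test b s ≡ false →
    ⟨ WHILE b DO c , s ⟩⇓[ testCost b ] s

  run-loop : ∀ {b c s s′ s″ t t′} → test b s ≡ true →
    ⟨ c , s ⟩⇓[ t ] s′ → ⟨ WHILE b DO c , s′ ⟩⇓[ t′ ] s″ →
    ⟨ WHILE b DO c , s ⟩⇓[ testCost b + (t + t′) ] s″

record AdjacencyLists {n} (G : Graph n) : Set where
  field
    neighbours : Fin n → List (Fin n)
    unique     : ∀ v → Unique (neighbours v)
    complete   : ∀ v w → w ∈ₗ neighbours v ⇔ Edge G v w

-- Variable 0 holds n.  Array 1 holds the adjacency lists of the vertices
-- 0, …, n - 1 one after another; the list of v occupies the positions from
-- (array 0)[v] up to but excluding (array 0)[v + 1].  All else is zero.
encode : ∀ {n} {G : Graph n} → AdjacencyLists G → Store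
encode {n} L = store initVars initArrays
  where
  lists : List (List ℕ)
  lists = map (map toℕ ∘ AdjacencyLists.neighbours L) (allFin n)

  initVars : ℕ → ℕ
  initVars zero    = n
  initVars (suc _) = 0

  initArrays : ℕ → ℕ → ℕ
  initArrays 0 i = length (concat (take i lists))
  initArrays 1 j = fromMaybe 0 (head (drop j (concat lists)))
  initArrays _ _ = 0

-- The computed vertex set consists of the v with (array 2)[v] nonzero.
decode : ∀ {n} → Store → Subset n
decode s = tabulate λ v → not (arrays s 2 (toℕ v) ≡ᵇ 0)

-- One program and one constant serve all graphs of the class.  The program
-- is given the graph only, with the neighbours listed in any order.
FindableInLinearTime : (Class : ∀ {n} → Graph n → Set) →
                       (Solution : ∀ {n} → Graph n → Subset n → Set) → Set
FindableInLinearTime Class Solution =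
  ∃[ program ] ∃[ c ]
    (∀ {n} (G : Graph n) → Class G → (L : AdjacencyLists G) →
     ∃[ t ] ∃[ s ] ⟨ program , encode L ⟩⇓[ t ] s
                 × t ≤ c * (n + edgeCount G)
                 × Solution G (decode s))

{-# OPTIONS --safe #-}

-- NC-path-tree graphs are chordal and claw-free.  Maximum cardinality search
-- yields a perfect elimination order of a chordal graph, and in that order
-- Farber's primal–dual scheme for independent domination runs greedily.  A
-- vertex with no marked neighbour enters the dual support Y; a vertex with
-- more neighbours in Y than in Z is marked, and enters Z if the excess is at
-- least two.  Claw-freeness bounds the number of neighbours in Y by two, so
-- that marked vertices satisfy |N[v] ∩ Y| = 1 + |{z ∈ Z : z = v or z is an
-- earlier neighbour of v}|, and all others the inequality ≤.  The set S
-- chosen greedily from the marked vertices in the reverse order dominates the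
-- graph, and double counting gives |S| + |Z| ≤ |Y| ≤ |D| + |Z| for every
-- independent dominating set D.  In a claw-free graph any dominating set can
-- be made independent without growing (Allan and Laskar).

module Submission where

open import Data.Bool.Base using (Bool; T; _∨_; false; if_then_else_; not; true)
open import Data.Bool.Properties using (T?)
open import Data.Empty using (⊥)
open import Data.Fin.Base using (Fin; suc; toℕ; zero) renaming (_<_ to _<ᶠ_)
import Data.Fin.Properties as Fin
open import Data.Fin.Subset using (Subset; ∣_∣) renaming (_∈_ to _∈ˢ_)
open import Data.List.Base using (List; []; [_]; _++_; _∷_; allFin; cartesianProduct; concat; drop;
  filter; head; length; map; reverse; tabulate; take; upTo)
open import Data.List.Membership.Propositional using (_∈_; _∉_)
open import Data.List.Membership.Propositional.Properties using (∈-++⁺ʳ; ∈-++⁺ˡ; ∈-++⁻; ∈-allFin;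
  ∈-filter⁺; ∈-filter⁻; ∈-map⁺; ∈-map⁻; ∈-upTo⁺; ∈-∃++)
open import Data.List.Properties using (length-++; length-map; length-reverse; length-tabulate;
  unfold-reverse)
open import Data.List.Relation.Unary.All using ([]; _∷_)
open import Data.List.Relation.Unary.All.Properties using (¬Any⇒All¬)
open import Data.List.Relation.Unary.AllPairs using ([]; _∷_)
open import Data.List.Relation.Unary.Any using (Any; any?; here; there)
open import Data.List.Relation.Unary.Linked using (Linked; [-]; []; _∷_)
open import Data.List.Relation.Unary.Unique.Propositional using (Unique)
open import Data.List.Relation.Unary.Unique.Propositional.Properties using (Unique[x∷xs]⇒x∉xs;
  allFin⁺; upTo⁺) renaming (filter⁺ to Unique-filter⁺; map⁺ to Unique-map⁺)
open import Data.Maybe.Base using (fromMaybe)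
open import Data.Nat.Base using (_*_; _+_; _<_; _<ᵇ_; _∸_; _≡ᵇ_; _≤_; _≥_; pred; suc; s≤s; z<s;
  zero; z≤n; ℕ)
open import Data.Nat.Properties using (*-assoc; *-distribʳ-+; *-distribˡ-+; *-monoʳ-≤; *-monoˡ-≤;
  +-assoc; +-cancelʳ-≤; +-cancelˡ-≤; +-comm; +-commutativeSemigroup; +-identityʳ; +-mono-≤;
  +-monoʳ-≤; +-monoˡ-≤; +-suc; <-asym; <-irrefl; <-trans; <-≤-trans; <ᵇ⇒<; <⇒<ᵇ; <⇒≱; _<?_; _≟_;
  m+[n∸m]≡n; m<m+n; module ≤-Reasoning; m≤m*n; m≤m+n; m≤n+m; m≤n⇒m<n∨m≡n; m≤n⇒m≤1+n; n<1+n; n≤1+n;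
  pred[n]≤n; ≡ᵇ⇒≡; ≡⇒≡ᵇ; ≤-antisym; ≤-pred; ≤-refl; ≤-reflexive; ≤-trans; ≤⇒≯; ≤∧≢⇒<; ≮⇒≥)
open import Data.Nat.Solver using (module +-*-Solver)
open import Data.Product.Base using (_,_; _×_; proj₁; proj₂; ∃-syntax)
import Data.Sum.Base as Sum
open import Data.Sum.Base using (_⊎_; inj₁; inj₂)
open import Data.Unit.Base using (tt)
open import Data.Vec.Base using ([]; _∷_) renaming (here to hereᵛ; there to thereᵛ)
open import Data.Vec.Properties using ([]=⇒lookup; lookup⇒[]=; lookup∘tabulate)
open import Function.Base using (_∘_; flip; id)
open import Function.Bundles using (mk⇔; module Equivalence)
import Relation.Binary.Construct.Closure.ReflexiveTransitive as Star
open import Relation.Binary.Construct.Closure.ReflexiveTransitive using (Star; _◅_; _◅◅_; ε)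
open import Relation.Binary.Definitions using (Symmetric; tri<; tri>; tri≈)
open import Relation.Binary.PropositionalEquality using (_≡_; _≢_; cong; cong₂; module ≡-Reasoning;
  refl; subst; subst₂; sym; trans)
open import Relation.Nullary.Decidable using (Dec; _×-dec_; _⊎-dec_; decidable-stable; does; no;
  yes; ¬?)
open import Relation.Nullary.Negation using (contradiction; ¬_)
open import Defs
open import Algebra.Properties.CommutativeSemigroup +-commutativeSemigroup using (interchange;
  x∙yz≈y∙xz)

-- The linear program behind the scheme has for each vertex `i` the covering constraint that the
-- closed neighbourhood of `i` is hit, and for each `z` the packing constraint that the clique of
-- `z` and its earlier neighbours is hit at most once. The packing constraints are valid for
-- independent sets only, which is why an arbitrary dominating set has to be made independent before
-- it can be compared. Making a marked vertex tight requires the weight of its clique to be the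
-- excess minus one. As the excess is at most two, this weight is 0 or 1; so both dual vectors are
-- plain vertex sets, and the machine gets by with neighbour counters.
--
-- The search is linear only in the amortised sense: its bucket pointer rises by one per visit and
-- therefore falls at most as often, and the queue receives one entry per vertex and one per entry
-- of the adjacency lists.

infix 4 _∈?_
_∈?_ : ∀ {n} (x : Fin n) xs → Dec (x ∈ xs)
x ∈? xs = any? (x Fin.≟_) xs

∉∧∈⇒≢ : {A : Set} {x y : A} {xs : List A} → x ∉ xs → y ∈ xs → x ≢ y
∉∧∈⇒≢ x∉ y∈ refl = x∉ y∈

∉⇒Unique : {A : Set} {x : A} {xs : List A} → x ∉ xs → Unique xs → Unique (x ∷ xs)
∉⇒Unique x∉ u = ¬Any⇒All¬ _ x∉ ∷ u

-- Walks in graphs and bridges of trees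

Edge-sym : ∀ {n} (G : Graph n) {u v} → Edge G u v → Edge G v u
Edge-sym G {u} {v} = subst T (Graph.adj-sym G u v)

Edge-irrefl : ∀ {n} (G : Graph n) {v} → ¬ Edge G v v
Edge-irrefl G {v} = subst T (Graph.no-loop G v)

Edge⇒≢ : ∀ {n} (G : Graph n) {u v} → Edge G u v → u ≢ v
Edge⇒≢ G e refl = Edge-irrefl G e

-- The list holds the vertices after the starting point, so that `x ∷ ws` is the vertex sequence in
-- the form that `Acyclic` asks for.
data Trail {A : Set} (R : A → A → Set) : A → A → List A → Set where
  []  : ∀ {x} → Trail R x x []
  _∷_ : ∀ {x y z ws} → R x z → Trail R z y ws → Trail R x y (z ∷ ws)

Trail-cut : {A : Set} {R : A → A → Set} {x y z : A} {ws : List A} → z ∈ x ∷ ws →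
            Trail R x y ws → Unique (x ∷ ws) →
            ∃[ ws′ ] Trail R z y ws′ × Unique (z ∷ ws′)
Trail-cut (here refl) t          u       = _ , t , u
Trail-cut (there z∈)  (_ ∷ t) (_ ∷ u) = Trail-cut z∈ t u

Star⇒Trail : ∀ {k} {R : Fin k → Fin k → Set} {x y} → Star R x y →
             ∃[ ws ] Trail R x y ws × Unique (x ∷ ws)
Star⇒Trail ε = [] , [] , [] ∷ []
Star⇒Trail {x = x} (r ◅ rs) with Star⇒Trail rs
... | ws , t , u with x ∈? _ ∷ ws
...   | yes x∈ = Trail-cut x∈ t u
...   | no  x∉ = _ , r ∷ t , ∉⇒Unique x∉ u

Trail-close : {A : Set} {R S : A → A → Set} {x y z : A} {ws : List A} → (∀ {a b} → R a b → S a b) →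
              Trail R x y ws → S y z → Linked S (x ∷ ws ++ [ z ])
Trail-close f []      s = s ∷ [-]
Trail-close f (r ∷ t) s = f r ∷ Trail-close f t s

module _ {k} (H : Graph k) where

  EdgeExcept : Fin k → Fin k → Fin k → Fin k → Set
  EdgeExcept s t a b = Edge H a b × ¬ (a ≡ s × b ≡ t) × ¬ (a ≡ t × b ≡ s)

  EdgeExcept-sym : ∀ {s t} → Symmetric (EdgeExcept s t)
  EdgeExcept-sym (e , ¬st , ¬ts) =
    Edge-sym H e , (λ (p , q) → ¬ts (q , p)) , (λ (p , q) → ¬st (q , p))

  -- A walk avoiding the edge can be shortened to a trail without repetitions, and the edge closes
  -- this trail to a cycle. Trails of fewer than two steps are excluded by looplessness and by the
  -- avoided edge itself.
  bridge : Acyclic H → ∀ {s t} → Edge H s t → ¬ Star (EdgeExcept s t) s t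
  bridge acyclic {s} e walk with Star⇒Trail walk
  ... | [] , [] , _ = Edge-irrefl H e
  ... | _ ∷ [] , (_ , ¬st , _) ∷ [] , _ = ¬st (refl , refl)
  ... | ws@(_ ∷ _ ∷ _) , t , u =
    acyclic s ws (s≤s (s≤s z≤n)) u (Trail-close proj₁ t (Edge-sym H e))

Within : {A : Set} → (A → A → Set) → List A → A → A → Set
Within R xs a b = R a b × a ∈ xs × b ∈ xs

head-walk : {A : Set} {R : A → A → Set} {x y : A} {xs : List A} →
            Linked R (x ∷ xs) → y ∈ x ∷ xs → Star (Within R (x ∷ xs)) x y
head-walk _        (here refl) = ε
head-walk (r ∷ rs) (there y∈)  =
  (r , here refl , there (here refl)) ◅
  Star.map (λ (s , p , q) → s , there p , there q) (head-walk rs y∈)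

Linked-walk : {A : Set} {R : A → A → Set} → Symmetric R → ∀ {x y : A} {xs : List A} →
              Linked R xs → x ∈ xs → y ∈ xs → Star (Within R xs) x y
Linked-walk s {xs = _ ∷ _} l x∈ y∈ =
  Star.reverse (λ (r , p , q) → s r , q , p) (head-walk l x∈) ◅◅ head-walk l y∈

-- Uniqueness ensures that the remainder of the trail does not return to `s`; it therefore avoids
-- the edge from `s` to `t` in both directions.
first-exit : ∀ {k} {R : Fin k → Fin k → Set} {a b ws} {P : List (Fin k)} →
             Trail R a b ws → Unique (a ∷ ws) → a ∈ P → b ∉ P →
             ∃[ s ] ∃[ t ] ∃[ ws′ ] R s t × s ∈ P × t ∉ P × Trail R t b ws′ × s ∉ t ∷ ws′
first-exit [] _ a∈ b∉ = contradiction a∈ b∉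
first-exit {P = P} (_∷_ {z = z} r t) u@(_ ∷ u′) a∈ b∉ with z ∈? P
... | yes z∈ = first-exit t u′ z∈ b∉
... | no  z∉ = _ , _ , _ , r , a∈ , z∉ , t , Unique[x∷xs]⇒x∉xs u

Trail⇒Star : {A : Set} {R S : A → A → Set} {x y : A} {ws : List A} →
             (∀ {a b} → a ∈ x ∷ ws → b ∈ x ∷ ws → R a b → S a b) → Trail R x y ws → Star S x y
Trail⇒Star f []      = ε
Trail⇒Star f (r ∷ t) =
  f (here refl) (there (here refl)) r ◅ Trail⇒Star (λ a∈ b∈ → f (there a∈) (there b∈)) t

-- Path-tree graphs are chordal

module _ {n} (G : Graph n) where

  Far : Fin n → Fin n → Set
  Far x u = u ≢ x × ¬ Edge G u x

  FarEdge : Fin n → Fin n → Fin n → Set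
  FarEdge x u v = Edge G u v × Far x u × Far x v

  -- Chordality in the form in which it is used: two neighbours of x joined
  -- by a walk that otherwise stays outside the closed neighbourhood of x
  -- are adjacent.
  Chordal : Set
  Chordal = ∀ {x p q u v} → Edge G p x → Edge G q x → p ≢ q →
            Edge G p u → Far x u → Star (FarEdge x) u v → Edge G v q → Edge G p q

  ClawFree : Set
  ClawFree = ∀ {c x y z} → Edge G c x → Edge G c y → Edge G c z →
             x ≢ y → y ≢ z → x ≢ z →
             ¬ Edge G x y → ¬ Edge G y z → ¬ Edge G x z → ⊥

  edge? : ∀ u v → Dec (Edge G u v)
  edge? u v = T? (Graph.adj G u v)

module _ {n} {G : Graph n} (M : PathTreeModel G) where
  open PathTreeModel M

  private
    E : Fin n → Fin n → Set
    E = Edge G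

    V : Fin n → List (Fin size)
    V v = nodes (path v)

  meet : ∀ {u v} → E u v → ∃[ x ] x ∈ V u × x ∈ V v
  meet {u} {v} e = Equivalence.to (intersection u v (Edge⇒≢ G e)) e

  disjoint : ∀ {u v a} → Far G u v → a ∈ V u → a ∉ V v
  disjoint {u} {v} (≢ , ¬e) p q = ¬e (Equivalence.from (intersection v u ≢) (_ , q , p))

  path-walk : ∀ v {a b} → a ∈ V v → b ∈ V v → Star (Within (Edge tree) (V v)) a b
  path-walk v = Linked-walk (Edge-sym tree) (Path.linked (path v))

  -- The walk stays on the path of `v`, and a path that misses an end of a tree edge cannot traverse
  -- that edge.
  detour : ∀ {s t} v {a b} → s ∉ V v ⊎ t ∉ V v → a ∈ V v → b ∈ V v →
           Star (EdgeExcept tree s t) a b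
  detour {s} {t} v out a∈ b∈ = Star.map (λ (e , p , q) → e , avoid out p q) (path-walk v a∈ b∈)
    where
    avoid : ∀ {a b} → s ∉ V v ⊎ t ∉ V v → a ∈ V v → b ∈ V v → ¬ (a ≡ s × b ≡ t) × ¬ (a ≡ t × b ≡ s)
    avoid (inj₁ s∉) a∈ b∈ = (λ { (refl , _) → s∉ a∈ }) , (λ { (_ , refl) → s∉ b∈ })
    avoid (inj₂ t∉) a∈ b∈ = (λ { (_ , refl) → t∉ b∈ }) , (λ { (refl , _) → t∉ a∈ })

  -- No path of a vertex far from `x` contains `s`. Glued at common nodes, the paths along the walk
  -- give a tree walk that avoids `s` and with it the edge.
  far-detour : ∀ {x s t} → s ∈ V x → ∀ {u v} → Star (FarEdge G x) u v → Far G x u →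
               ∀ {a b} → a ∈ V u → b ∈ V v → Star (EdgeExcept tree s t) a b
  far-detour s∈ {u} ε far a∈ b∈ = detour u (inj₁ (disjoint far s∈)) a∈ b∈
  far-detour s∈ {u} ((e , _ , far′) ◅ walk) far a∈ b∈ with meet e
  ... | c , c∈u , c∈ = detour u (inj₁ (disjoint far s∈)) a∈ c∈u ◅◅ far-detour s∈ walk far′ c∈ b∈

  -- If p and q were not adjacent, the path of x would leave the path of p
  -- through a tree edge s–t on its way to the path of q; the walk outside
  -- the neighbourhood of x then bypasses that edge.
  pathTree⇒Chordal : Chordal G
  pathTree⇒Chordal {x} {p} {q} {u} {v} px qx p≢q pu far walk vq = decidable-stable (edge? G p q) λ ¬pq →
    let far-pq            = p≢q ∘ sym , ¬pq ∘ Edge-sym G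
        a , a∈p , a∈x     = meet px
        b , b∈q , b∈x     = meet qx
        c , c∈p , c∈u     = meet pu
        d , d∈v , d∈q     = meet vq
        _ , trail , uniq  = Star⇒Trail (path-walk x a∈x b∈x)
        s , t , _ , (st , s∈x , _) , s∈p , t∉p , rest , s∉rest =
          first-exit trail uniq a∈p (λ b∈p → disjoint far-pq b∈p b∈q)
        back = Trail⇒Star
                 (λ a∈ b∈ (e , _ , _) →
                   e , (λ (a≡s , _) → s∉rest (subst (_∈ _) a≡s a∈))
                     , (λ (_ , b≡s) → s∉rest (subst (_∈ _) b≡s b∈)))
                 rest
    in bridge tree (proj₂ isTree) st
         (detour p (inj₂ t∉p) s∈p c∈p ◅◅
          far-detour s∈x walk far c∈u d∈v ◅◅
          detour q (inj₁ (disjoint far-pq s∈p)) d∈q b∈q ◅◅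
          Star.reverse (EdgeExcept-sym tree) back)

-- Betweenness on a path and claw-freeness

Before : {A : Set} → List A → A → A → Set
Before zs b d = ∃[ xs ] ∃[ ys ] zs ≡ xs ++ b ∷ ys × d ∈ ys

Ordered : {A : Set} → List A → A → A → A → Set
Ordered zs a b d = ∃[ xs ] ∃[ ys ] zs ≡ xs ++ b ∷ ys × a ∈ xs × d ∈ ys

Before⇒Ordered : {A : Set} {a b d : A} {zs : List A} → Before zs b d → Ordered (a ∷ zs) a b d
Before⇒Ordered (xs , ys , refl , d∈) = _ ∷ xs , ys , refl , here refl , d∈

Ordered-∷ : {A : Set} {z a b d : A} {zs : List A} → Ordered zs a b d → Ordered (z ∷ zs) a b d
Ordered-∷ (xs , ys , refl , a∈ , d∈) = _ ∷ xs , ys , refl , there a∈ , d∈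

Before-total : {A : Set} {b d : A} {zs : List A} → b ∈ zs → d ∈ zs → b ≢ d →
               Before zs b d ⊎ Before zs d b
Before-total (here refl) (here refl) b≢d = contradiction refl b≢d
Before-total (here refl) (there d∈)  _   = inj₁ ([] , _ , refl , d∈)
Before-total (there b∈)  (here refl) _   = inj₂ ([] , _ , refl , b∈)
Before-total (there b∈)  (there d∈)  b≢d with Before-total b∈ d∈ b≢d
... | inj₁ (xs , ys , refl , p) = inj₁ (_ ∷ xs , ys , refl , p)
... | inj₂ (xs , ys , refl , p) = inj₂ (_ ∷ xs , ys , refl , p)

-- The six refutations come in pairs, one for each choice of the middle element: a claw is refuted
-- by the leaf whose path meets that of the centre in the middle.
some-order : {A : Set} {a b d : A} {zs : List A} → a ∈ zs → b ∈ zs → d ∈ zs → a ≢ b → b ≢ d → a ≢ d →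
             ¬ Ordered zs a b d → ¬ Ordered zs d b a → ¬ Ordered zs b a d →
             ¬ Ordered zs d a b → ¬ Ordered zs a d b → ¬ Ordered zs b d a → ⊥
some-order (here refl) (here refl) _ a≢b _ _ = contradiction refl a≢b
some-order (here refl) (there _) (here refl) _ _ a≢d = contradiction refl a≢d
some-order (there _) (here refl) (here refl) _ b≢d _ = contradiction refl b≢d
some-order (here refl) (there b∈) (there d∈) _ b≢d _ abd _ _ _ adb _ with Before-total b∈ d∈ b≢d
... | inj₁ bd = abd (Before⇒Ordered bd)
... | inj₂ db = adb (Before⇒Ordered db)
some-order (there a∈) (here refl) (there d∈) _ _ a≢d _ _ bad _ _ bda with Before-total a∈ d∈ a≢d
... | inj₁ ad = bad (Before⇒Ordered ad)
... | inj₂ da = bda (Before⇒Ordered da)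
some-order (there a∈) (there b∈) (here refl) a≢b _ _ _ dba _ dab _ _ with Before-total a∈ b∈ a≢b
... | inj₁ ab = dab (Before⇒Ordered ab)
... | inj₂ ba = dba (Before⇒Ordered ba)
some-order (there a∈) (there b∈) (there d∈) a≢b b≢d a≢d abd dba bad dab adb bda =
  some-order a∈ b∈ d∈ a≢b b≢d a≢d (abd ∘ Ordered-∷) (dba ∘ Ordered-∷) (bad ∘ Ordered-∷)
             (dab ∘ Ordered-∷) (adb ∘ Ordered-∷) (bda ∘ Ordered-∷)

∉-after : {A : Set} {b d : A} (xs : List A) {ys : List A} → Unique (xs ++ b ∷ ys) → d ∈ ys → d ∉ b ∷ xs
∉-after []       u        d∈ (here refl)          = Unique[x∷xs]⇒x∉xs u d∈
∉-after (x ∷ xs) u        d∈ (there (here refl))  = Unique[x∷xs]⇒x∉xs u (∈-++⁺ʳ xs (there d∈))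
∉-after (x ∷ xs) (_ ∷ u)  d∈ (here refl)          = ∉-after xs u d∈ (here refl)
∉-after (x ∷ xs) (_ ∷ u)  d∈ (there (there d∈xs)) = ∉-after xs u d∈ (there d∈xs)

Consecutive-∷⁻ : {A : Set} {x u w : A} {zs : List A} → Consecutive (x ∷ zs) u w →
                 (x ≡ u × ∃[ ys ] zs ≡ w ∷ ys) ⊎ Consecutive zs u w
Consecutive-∷⁻ ([]     , ys , refl) = inj₁ (refl , ys , refl)
Consecutive-∷⁻ (_ ∷ xs , ys , refl) = inj₂ (xs , ys , refl)

Consecutive-∈ : {A : Set} {u w : A} {zs : List A} → Consecutive zs u w → u ∈ zs × w ∈ zs
Consecutive-∈ (xs , _ , refl) = ∈-++⁺ʳ xs (here refl) , ∈-++⁺ʳ xs (there (here refl))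

-- `b` separates `xs` from `ys`: a step out of the prefix would have to use `b` as one of its ends.
step-stays : {A : Set} {b u w : A} (xs : List A) {ys : List A} → Unique (xs ++ b ∷ ys) →
             u ≢ b → w ≢ b → Consecutive (xs ++ b ∷ ys) u w ⊎ Consecutive (xs ++ b ∷ ys) w u →
             u ∈ xs → w ∈ xs
step-stays (x ∷ xs) uniq@(_ ∷ uniq′) u≢ w≢ (inj₁ c) u∈ with Consecutive-∷⁻ c
step-stays (x ∷ [])    _ u≢ w≢ (inj₁ c) u∈ | inj₁ (refl , _ , refl) = contradiction refl w≢
step-stays (x ∷ _ ∷ _) _ u≢ w≢ (inj₁ c) u∈ | inj₁ (refl , _ , refl) = there (here refl)
step-stays (x ∷ xs) uniq _ _ (inj₁ c) (here refl) | inj₂ c′ =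
  contradiction (proj₁ (Consecutive-∈ c′)) (Unique[x∷xs]⇒x∉xs uniq)
step-stays (x ∷ xs) (_ ∷ uniq) u≢ w≢ (inj₁ c) (there u∈) | inj₂ c′ =
  there (step-stays xs uniq u≢ w≢ (inj₁ c′) u∈)
step-stays (x ∷ xs) uniq u≢ w≢ (inj₂ c) u∈ with Consecutive-∷⁻ c
... | inj₁ (refl , _) = here refl
step-stays (x ∷ xs) uniq _ _ (inj₂ c) (here refl) | inj₂ c′ =
  contradiction (proj₂ (Consecutive-∈ c′)) (Unique[x∷xs]⇒x∉xs uniq)
step-stays (x ∷ xs) (_ ∷ uniq) u≢ w≢ (inj₂ c) (there u∈) | inj₂ c′ =
  there (step-stays xs uniq u≢ w≢ (inj₂ c′) u∈)

-- A walk within the difference cannot pass `b`, which lies on `Q`; started at `a`, it never leaves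
-- the entries before `b` and misses `d`.
difference-unordered : ∀ {k} {H : Graph k} (P Q : Path H) → DifferenceConnected P Q →
                       ∀ {a b d} → a ∉ nodes Q → b ∈ nodes Q → d ∉ nodes Q → ¬ Ordered (nodes P) a b d
difference-unordered P Q conn {a} {b} {d} a∉ b∈ d∉ (xs , ys , eq , a∈ , d∈) =
  ∉-after xs uniq d∈ (there (stays
    (conn a d (subst (a ∈_) (sym eq) (∈-++⁺ˡ a∈) , a∉)
              (subst (d ∈_) (sym eq) (∈-++⁺ʳ xs (there d∈)) , d∉))
    a∈))
  where
  uniq : Unique (xs ++ b ∷ ys)
  uniq = subst Unique eq (Path.distinct P)

  stays : ∀ {u w} → Star (λ u w → u ∈ P ∖ Q × w ∈ P ∖ Q × PathEdge P u w) u w → u ∈ xs → w ∈ xs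
  stays ε u∈ = u∈
  stays (((_ , u∉) , (_ , w∉) , e) ◅ walk) u∈ =
    stays walk (step-stays xs uniq (∉∧∈⇒≢ u∉ b∈) (∉∧∈⇒≢ w∉ b∈)
      (subst (λ zs → Consecutive zs _ _ ⊎ Consecutive zs _ _) eq e) u∈)

module _ {n} {G : Graph n} (M : PathTreeModel G) where
  open PathTreeModel M

  -- Pairwise nonadjacent neighbours of `c` have disjoint paths and so meet the path of `c` in three
  -- distinct nodes. The path through the middle node misses the other two and separates them on the
  -- path of `c`, although the difference has to be connected.
  nonCrossing⇒ClawFree : (∀ u v → u ≢ v → NonCrossing (path u) (path v)) → ClawFree G
  nonCrossing⇒ClawFree nc {c} {x} {y} {z} cx cy cz x≢y y≢z x≢z ¬xy ¬yz ¬xz =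
    let a , a∈c , a∈x = meet M cx
        b , b∈c , b∈y = meet M cy
        d , d∈c , d∈z = meet M cz
        xy = x≢y , ¬xy
        yz = y≢z , ¬yz
        xz = x≢z , ¬xz
        unordered : ∀ {u} → Edge G c u → ∀ {a b d} → a ∉ nodes (path u) → b ∈ nodes (path u) →
                    d ∉ nodes (path u) → ¬ Ordered (nodes (path c)) a b d
        unordered {u} cu = difference-unordered (path c) (path u) (proj₁ (nc c u (Edge⇒≢ G cu)))
        a∉y = disjoint M (far-sym xy) a∈x
        a∉z = disjoint M (far-sym xz) a∈x
        b∉x = disjoint M xy b∈y
        b∉z = disjoint M (far-sym yz) b∈y
        d∉x = disjoint M xz d∈z
        d∉y = disjoint M yz d∈z
    in some-order a∈c b∈c d∈c
         (∉∧∈⇒≢ a∉y b∈y) (∉∧∈⇒≢ b∉z d∈z) (∉∧∈⇒≢ a∉z d∈z)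
         (unordered cy a∉y b∈y d∉y) (unordered cy d∉y b∈y a∉y)
         (unordered cx b∉x a∈x d∉x) (unordered cx d∉x a∈x b∉x)
         (unordered cz a∉z d∈z b∉z) (unordered cz b∉z d∈z a∉z)
    where
    far-sym : ∀ {u v} → Far G v u → Far G u v
    far-sym (≢ , ¬e) = ≢ ∘ sym , ¬e ∘ Edge-sym G

-- Finite sums and counting

private variable
  A B : Set

∑ : List A → (A → ℕ) → ℕ
∑ []       f = 0
∑ (x ∷ xs) f = f x + ∑ xs f

∑-mono : ∀ xs {f g : A → ℕ} → (∀ {x} → x ∈ xs → f x ≤ g x) → ∑ xs f ≤ ∑ xs g
∑-mono []       h = z≤n
∑-mono (x ∷ xs) h = +-mono-≤ (h (here refl)) (∑-mono xs (h ∘ there))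

∑-cong : ∀ xs {f g : A → ℕ} → (∀ {x} → x ∈ xs → f x ≡ g x) → ∑ xs f ≡ ∑ xs g
∑-cong []       h = refl
∑-cong (x ∷ xs) h = cong₂ _+_ (h (here refl)) (∑-cong xs (h ∘ there))

∑-+ : ∀ xs (f g : A → ℕ) → ∑ xs (λ x → f x + g x) ≡ ∑ xs f + ∑ xs g
∑-+ []       f g = refl
∑-+ (x ∷ xs) f g rewrite ∑-+ xs f g = interchange (f x) (g x) (∑ xs f) (∑ xs g)

∑-0 : ∀ (xs : List A) → ∑ xs (λ _ → 0) ≡ 0
∑-0 []       = refl
∑-0 (_ ∷ xs) = ∑-0 xs

∑-1 : ∀ (xs : List A) → ∑ xs (λ _ → 1) ≡ length xs
∑-1 []       = refl
∑-1 (_ ∷ xs) = cong suc (∑-1 xs)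

∑-++ : ∀ xs ys (f : A → ℕ) → ∑ (xs ++ ys) f ≡ ∑ xs f + ∑ ys f
∑-++ []       ys f = refl
∑-++ (x ∷ xs) ys f rewrite ∑-++ xs ys f = sym (+-assoc (f x) (∑ xs f) (∑ ys f))

∑-swap : ∀ xs ys (f : A → B → ℕ) → ∑ xs (λ x → ∑ ys (f x)) ≡ ∑ ys (λ y → ∑ xs (λ x → f x y))
∑-swap []       ys f = sym (∑-0 ys)
∑-swap (x ∷ xs) ys f rewrite ∑-swap xs ys f = sym (∑-+ ys (f x) _)

∑-suc : ∀ xs (f : A → ℕ) → ∑ xs (suc ∘ f) ≡ length xs + ∑ xs f
∑-suc xs f = trans (∑-+ xs (λ _ → 1) f) (cong (_+ ∑ xs f) (∑-1 xs))

∑-⊆ : ∀ {xs ys} (f : A → ℕ) → Unique xs → (∀ {x} → x ∈ xs → x ∈ ys) → ∑ xs f ≤ ∑ ys f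
∑-⊆ {xs = []}     f _ _ = z≤n
∑-⊆ {xs = x ∷ xs} f u@(_ ∷ u′) xs⊆ys with ∈-∃++ (xs⊆ys (here refl))
... | as , bs , refl = begin
  f x + ∑ xs f           ≤⟨ +-monoʳ-≤ (f x) (∑-⊆ f u′ rest) ⟩
  f x + ∑ (as ++ bs) f   ≡⟨ cong (f x +_) (∑-++ as bs f) ⟩
  f x + (∑ as f + ∑ bs f) ≡⟨ x∙yz≈y∙xz (f x) (∑ as f) (∑ bs f) ⟩
  ∑ as f + ∑ (x ∷ bs) f  ≡⟨ ∑-++ as (x ∷ bs) f ⟨
  ∑ (as ++ x ∷ bs) f     ∎
  where
  open ≤-Reasoning
  rest : ∀ {y} → y ∈ xs → y ∈ as ++ bs
  rest y∈ with ∈-++⁻ as (xs⊆ys (there y∈))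
  ... | inj₁ y∈as         = ∈-++⁺ˡ y∈as
  ... | inj₂ (here refl)  = contradiction y∈ (Unique[x∷xs]⇒x∉xs u)
  ... | inj₂ (there y∈bs) = ∈-++⁺ʳ as y∈bs

length-⊆ : ∀ {xs ys : List A} → Unique xs → (∀ {x} → x ∈ xs → x ∈ ys) → length xs ≤ length ys
length-⊆ {xs = xs} {ys} u xs⊆ys = subst₂ _≤_ (∑-1 xs) (∑-1 ys) (∑-⊆ (λ _ → 1) u xs⊆ys)

bit : {X : Set} → Dec X → ℕ
bit d = if does d then 1 else 0

bit-yes : {X : Set} (d : Dec X) → X → bit d ≡ 1
bit-yes (yes _) _ = refl
bit-yes (no ¬x) x = contradiction x ¬x

bit-no : {X : Set} (d : Dec X) → ¬ X → bit d ≡ 0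
bit-no (yes x) ¬x = contradiction x ¬x
bit-no (no _)  _  = refl

bit≤1 : {X : Set} (d : Dec X) → bit d ≤ 1
bit≤1 (yes _) = ≤-refl
bit≤1 (no _)  = z≤n

bit-mono : {X Y : Set} (d : Dec X) (e : Dec Y) → (X → Y) → bit d ≤ bit e
bit-mono (yes x) e f = ≤-reflexive (sym (bit-yes e (f x)))
bit-mono (no _)  e f = z≤n

bit-cong : {X Y : Set} (d : Dec X) (e : Dec Y) → (X → Y) → (Y → X) → bit d ≡ bit e
bit-cong (yes x) e f g = sym (bit-yes e (f x))
bit-cong (no ¬x) e f g = sym (bit-no e (¬x ∘ g))

count : {P : A → Set} → (∀ x → Dec (P x)) → List A → ℕ
count P? xs = ∑ xs (bit ∘ P?)

count-mono : {P : A → Set} (P? : ∀ x → Dec (P x)) {Q : A → Set} (Q? : ∀ x → Dec (Q x)) → ∀ xs →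
             (∀ {x} → x ∈ xs → P x → Q x) → count P? xs ≤ count Q? xs
count-mono P? Q? xs h = ∑-mono xs λ {x} x∈ → bit-mono (P? x) (Q? x) (h x∈)

count-cong : {P : A → Set} (P? : ∀ x → Dec (P x)) {Q : A → Set} (Q? : ∀ x → Dec (Q x)) → ∀ xs →
             (∀ {x} → x ∈ xs → P x → Q x) → (∀ {x} → x ∈ xs → Q x → P x) → count P? xs ≡ count Q? xs
count-cong P? Q? xs h k = ∑-cong xs λ {x} x∈ → bit-cong (P? x) (Q? x) (h x∈) (k x∈)

count-none : {P : A → Set} (P? : ∀ x → Dec (P x)) → ∀ xs → (∀ {x} → x ∈ xs → ¬ P x) → count P? xs ≡ 0
count-none P? xs h = trans (∑-cong xs λ {x} x∈ → bit-no (P? x) (h x∈)) (∑-0 xs)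

count-some : {P : A → Set} (P? : ∀ x → Dec (P x)) → ∀ {xs x} → x ∈ xs → P x → 1 ≤ count P? xs
count-some P? {y ∷ ys} (here refl) p rewrite bit-yes (P? y) p = s≤s z≤n
count-some P? {y ∷ ys} (there x∈)  p = ≤-trans (count-some P? x∈ p) (m≤n+m _ (bit (P? y)))

count≡0⇒none : {P : A → Set} (P? : ∀ x → Dec (P x)) → ∀ {xs} → count P? xs ≡ 0 → ∀ {x} → x ∈ xs → ¬ P x
count≡0⇒none P? c≡0 x∈ p with () ← subst (1 ≤_) c≡0 (count-some P? x∈ p)

count≢0⇒some : {P : A → Set} (P? : ∀ x → Dec (P x)) → ∀ xs → count P? xs ≢ 0 → ∃[ x ] x ∈ xs × P x
count≢0⇒some P? []       c≢0 = contradiction refl c≢0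
count≢0⇒some P? (x ∷ xs) c≢0 with P? x
... | yes p = x , here refl , p
... | no  _ with count≢0⇒some P? xs c≢0
...   | y , y∈ , p = y , there y∈ , p

count≤1 : {P : A → Set} (P? : ∀ x → Dec (P x)) → ∀ {xs} → Unique xs →
          (∀ {x y} → x ∈ xs → y ∈ xs → P x → P y → x ≡ y) → count P? xs ≤ 1
count≤1 P? {[]}     _ _ = z≤n
count≤1 P? {x ∷ xs} u@(_ ∷ u′) same with P? x
... | no _  = count≤1 P? u′ λ x∈ y∈ → same (there x∈) (there y∈)
... | yes p = ≤-reflexive (cong suc (count-none P? xs λ {y} y∈ q →
  Unique[x∷xs]⇒x∉xs u (subst (_∈ xs) (sym (same (here refl) (there y∈) p q)) y∈)))

count-all : {P : A → Set} (P? : ∀ x → Dec (P x)) → ∀ xs → (∀ {x} → x ∈ xs → P x) → count P? xs ≡ length xs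
count-all P? xs h = trans (∑-cong xs λ {x} x∈ → bit-yes (P? x) (h x∈)) (∑-1 xs)

-- If `Q` implied `P` throughout the list, the element `a` would make the count of `P` strictly
-- larger.
count-exceeds : {P : A → Set} (P? : ∀ x → Dec (P x)) {Q : A → Set} (Q? : ∀ x → Dec (Q x)) → ∀ {xs} →
                count P? xs ≤ count Q? xs → ∀ {a} → a ∈ xs → P a → ¬ Q a →
                ∃[ d ] d ∈ xs × Q d × ¬ P d
count-exceeds {P = P} P? {Q = Q} Q? {xs} P≤Q {a} a∈ p ¬q with any-or-none xs
  where
  any-or-none : ∀ ys → (∃[ d ] d ∈ ys × Q d × ¬ P d) ⊎ (∀ {d} → d ∈ ys → Q d → P d)
  any-or-none [] = inj₂ λ ()
  any-or-none (y ∷ ys) with any-or-none ys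
  ... | inj₁ (d , d∈ , r) = inj₁ (d , there d∈ , r)
  ... | inj₂ h with Q? y | P? y
  ...   | yes q | no ¬p = inj₁ (y , here refl , q , ¬p)
  ...   | no ¬q | _     = inj₂ λ { (here refl) q → contradiction q ¬q ; (there d∈) → h d∈ }
  ...   | yes _ | yes p = inj₂ λ { (here refl) _ → p ; (there d∈) → h d∈ }
... | inj₁ r = r
... | inj₂ h = contradiction P≤Q (λ P≤Q → <-irrefl refl (<-≤-trans (strict a∈ h) P≤Q))
  where
  strict : ∀ {ys} → a ∈ ys → (∀ {d} → d ∈ ys → Q d → P d) → count Q? ys < count P? ys
  strict {y ∷ ys} (here refl) h rewrite bit-no (Q? y) ¬q | bit-yes (P? y) p =
    s≤s (count-mono Q? P? ys (h ∘ there))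
  strict {y ∷ ys} (there a∈) h = ≤-trans (≤-reflexive (sym (+-suc (bit (Q? y)) _)))
    (+-mono-≤ (bit-mono (Q? y) (P? y) (h (here refl))) (strict a∈ (h ∘ there)))

-- Linear programming duality for a 0/1 point X: r is the incidence of the
-- covering constraints Y, u that of the packing constraints Z.
module _ (X Y Z : List A) (r u : A → A → ℕ) where
  open ≤-Reasoning

  private
    rearrange : ∑ X (λ v → suc (∑ Z (λ z → u z v))) ≡ length X + ∑ Z (λ z → ∑ X (u z))
    rearrange = trans (∑-suc X _) (cong (length X +_) (∑-swap X Z (flip u)))

  weak-duality : (∀ {v} → v ∈ X → ∑ Y (r v) ≤ suc (∑ Z (λ z → u z v))) →
                 (∀ {i} → i ∈ Y → 1 ≤ ∑ X (λ v → r v i)) →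
                 (∀ {z} → z ∈ Z → ∑ X (u z) ≤ 1) →
                 length Y ≤ length X + length Z
  weak-duality feasible covered packed = begin
    length Y                                   ≡⟨ ∑-1 Y ⟨
    ∑ Y (λ _ → 1)                              ≤⟨ ∑-mono Y covered ⟩
    ∑ Y (λ i → ∑ X (λ v → r v i))              ≡⟨ ∑-swap X Y r ⟨
    ∑ X (λ v → ∑ Y (r v))                      ≤⟨ ∑-mono X feasible ⟩
    ∑ X (λ v → suc (∑ Z (λ z → u z v)))        ≡⟨ rearrange ⟩
    length X + ∑ Z (λ z → ∑ X (u z))           ≤⟨ +-monoʳ-≤ (length X) (∑-mono Z packed) ⟩
    length X + ∑ Z (λ _ → 1)                   ≡⟨ cong (length X +_) (∑-1 Z) ⟩
    length X + length Z                        ∎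

  complementary-slackness : (∀ {v} → v ∈ X → ∑ Y (r v) ≡ suc (∑ Z (λ z → u z v))) →
                            (∀ {i} → i ∈ Y → ∑ X (λ v → r v i) ≤ 1) →
                            (∀ {z} → z ∈ Z → 1 ≤ ∑ X (u z)) →
                            length X + length Z ≤ length Y
  complementary-slackness tight covered packed = begin
    length X + length Z                        ≡⟨ cong (length X +_) (∑-1 Z) ⟨
    length X + ∑ Z (λ _ → 1)                   ≤⟨ +-monoʳ-≤ (length X) (∑-mono Z packed) ⟩
    length X + ∑ Z (λ z → ∑ X (u z))           ≡⟨ rearrange ⟨
    ∑ X (λ v → suc (∑ Z (λ z → u z v)))        ≡⟨ ∑-cong X tight ⟨
    ∑ X (λ v → ∑ Y (r v))                      ≡⟨ ∑-swap X Y r ⟩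
    ∑ Y (λ i → ∑ X (λ v → r v i))              ≤⟨ ∑-mono Y covered ⟩
    ∑ Y (λ _ → 1)                              ≡⟨ ∑-1 Y ⟩
    length Y                                   ∎

-- The index counts from the end of the list, so it does not change when further elements are put in
-- front.
data Down {A : Set} (P : ℕ → A → Set) : List A → Set where
  []  : Down P []
  _∷_ : ∀ {x xs} → P (length xs) x → Down P xs → Down P (x ∷ xs)

-- Maximum cardinality search

module _ {n} (G : Graph n) where

  neighbourCount : Fin n → List (Fin n) → ℕ
  neighbourCount v = count (λ u → edge? G u v)

  -- The most recently visited vertex comes first.
  data MaxCardinality : List (Fin n) → Set where
    []  : MaxCardinality []
    _∷_ : ∀ {x xs} → (∀ {w} → w ∉ x ∷ xs → neighbourCount w xs ≤ neighbourCount x xs) →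
          MaxCardinality xs → MaxCardinality (x ∷ xs)

  Outside : List (Fin n) → Fin n → Fin n → Set
  Outside xs u v = Edge G u v × u ∉ xs × v ∉ xs

  outside-tail : ∀ {x xs u v} → Star (Outside (x ∷ xs)) u v → Star (Outside xs) u v
  outside-tail = Star.map (λ (e , u∉ , v∉) → e , u∉ ∘ there , v∉ ∘ there)

  outside-reverse : ∀ {xs u v} → Star (Outside xs) u v → Star (Outside xs) v u
  outside-reverse = Star.reverse (λ (e , u∉ , v∉) → Edge-sym G e , v∉ , u∉)

  -- The walk is cut at the last vertex `u′` adjacent to `a`. From its successor `w` up to `b`
  -- everything lies outside the closed neighbourhood of `a`, as `Chordal` requires; `w` may be `b`
  -- itself.
  last-neighbour : ∀ {xs a b u v} → Star (Outside xs) u v → u ∉ xs → a ∈ xs → Edge G v b → Far G a b →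
    (∃[ u′ ] ∃[ w ] Edge G a u′ × u′ ∉ xs × Star (Outside xs) u′ v ×
                    Edge G u′ w × Star (FarEdge G a) w b × Far G a w)
    ⊎ (Far G a u × Star (FarEdge G a) u b)
  last-neighbour {a = a} {u = u} ε u∉ a∈ vb far with edge? G a u
  ... | yes au = inj₁ (_ , _ , au , u∉ , ε , vb , ε , far)
  ... | no ¬au = let far-u = ∉∧∈⇒≢ u∉ a∈ , ¬au ∘ Edge-sym G in
                 inj₂ (far-u , (vb , far-u , far) ◅ ε)
  last-neighbour {a = a} {u = u} ((uw , _ , w∉) ◅ walk) u∉ a∈ vb far
    with last-neighbour walk w∉ a∈ vb far
  ... | inj₁ found = inj₁ found
  ... | inj₂ (far-w , rest) with edge? G a u
  ...   | yes au = inj₁ (_ , _ , au , u∉ , (uw , u∉ , w∉) ◅ walk , uw , rest , far-w)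
  ...   | no ¬au = let far-u = ∉∧∈⇒≢ u∉ a∈ , ¬au ∘ Edge-sym G in
                   inj₂ (far-u , (uw , far-u , far-w) ◅ rest)

  module _ (chordal : Chordal G) where

    -- Perfect elimination uses only the case where `u` is `v`. The walk is there for the induction:
    -- once `b` is dropped from the visited list, it prolongs the unvisited walk, which then joins
    -- `a` to a visited neighbour `d` of `b`.
    visited-clique : ∀ {xs} → MaxCardinality xs → Unique xs →
                     ∀ {a b u v} → a ∈ xs → b ∈ xs → a ≢ b →
                     Edge G a u → u ∉ xs → Star (Outside xs) u v → v ∉ xs → Edge G v b → Edge G a b

    -- If a and b were not adjacent, then b, having at least as many visited
    -- neighbours as the last neighbour u′ of a on the walk, would have one,
    -- d, that is not a neighbour of u′.  By induction d and a are adjacent,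
    -- so that a has the two neighbours d and u′ violating chordality.
    latest-clique : ∀ {b xs} → MaxCardinality (b ∷ xs) → Unique (b ∷ xs) →
                    ∀ {a u v} → a ∈ xs → Edge G a u → u ∉ b ∷ xs →
                    Star (Outside (b ∷ xs)) u v → v ∉ b ∷ xs → Edge G v b → Edge G a b
    latest-clique {b} {xs} (max ∷ mc) uniq@(_ ∷ uniq′) {a} {v = v} a∈ au u∉ walk v∉ vb =
      decidable-stable (edge? G a b) λ ¬ab →
      let b∉ = Unique[x∷xs]⇒x∉xs uniq
          far-b = ∉∧∈⇒≢ b∉ a∈ , ¬ab ∘ Edge-sym G
      in go ¬ab b∉ far-b (last-neighbour walk u∉ (there a∈) vb far-b)
      where
      go : ¬ Edge G a b → b ∉ xs → Far G a b → _ → ⊥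
      go ¬ab b∉ far-b (inj₂ ((_ , ¬ua) , _)) = ¬ua (Edge-sym G au)
      go ¬ab b∉ far-b (inj₁ (u′ , w , au′ , u′∉ , walk′ , u′w , far-walk , far-w))
        with count-exceeds (λ y → edge? G y u′) (λ y → edge? G y b) (max u′∉) a∈ au′ ¬ab
      ... | d , d∈ , db , ¬du′ =
        ¬du′ (chordal da (Edge-sym G au′) (∉∧∈⇒≢ (u′∉ ∘ there) d∈ ∘ sym)
                db far-b (Star.reverse (λ (e , p , q) → Edge-sym G e , q , p) far-walk)
                (Edge-sym G u′w))
        where
        a≢d : a ≢ d
        a≢d refl = ¬ab db

        da : Edge G d a
        da = Edge-sym G (visited-clique mc uniq′ a∈ d∈ a≢d au′ (u′∉ ∘ there)
               (outside-tail walk′ ◅◅ ((vb , v∉ ∘ there , b∉) ◅ ε)) b∉ (Edge-sym G db))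

    visited-clique _ _ (here refl) (here refl) a≢b _ _ _ _ _ = contradiction refl a≢b
    visited-clique mc uniq (there a∈) (here refl) _ au u∉ walk v∉ vb =
      latest-clique mc uniq a∈ au u∉ walk v∉ vb
    visited-clique mc uniq (here refl) (there b∈) _ au u∉ walk v∉ vb =
      Edge-sym G (latest-clique mc uniq b∈ (Edge-sym G vb) v∉ (outside-reverse walk) u∉ (Edge-sym G au))
    visited-clique (_ ∷ mc) (_ ∷ uniq) (there a∈) (there b∈) a≢b au u∉ walk v∉ vb =
      visited-clique mc uniq a∈ b∈ a≢b au (u∉ ∘ there) (outside-tail walk) (v∉ ∘ there) vb

  -- Vertices are eliminated in the order of decreasing position.
  record PerfectElimination (pos : Fin n → ℕ) : Set where
    field
      injective : ∀ {u v} → pos u ≡ pos v → u ≡ v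
      clique    : ∀ {v a b} → pos a < pos v → pos b < pos v → Edge G a v → Edge G b v → a ≢ b → Edge G a b

  module _ {pos : Fin n → ℕ} where

    Positions : List (Fin n) → Set
    Positions = Down (λ k x → pos x ≡ suc k)

    position-≤ : ∀ {vs v} → Positions vs → v ∈ vs → pos v ≤ length vs
    position-≤ (p ∷ ps) (here refl) = ≤-reflexive p
    position-≤ (p ∷ ps) (there v∈)  = m≤n⇒m≤1+n (position-≤ ps v∈)

    positive : ∀ {vs v} → Positions vs → v ∈ vs → 0 < pos v
    positive (p ∷ ps) (here refl) = subst (0 <_) (sym p) z<s
    positive (p ∷ ps) (there v∈)  = positive ps v∈

    position-< : ∀ {x xs v} → Positions (x ∷ xs) → v ∈ xs → pos v < pos x
    position-< {v = v} (p ∷ ps) v∈ = subst (pos v <_) (sym p) (s≤s (position-≤ ps v∈))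

    earlier-∈ : ∀ {x xs v} → Positions (x ∷ xs) → v ∈ x ∷ xs → pos v < pos x → v ∈ xs
    earlier-∈ ps (here refl) v<x = contradiction v<x (<-irrefl refl)
    earlier-∈ ps (there v∈)  _   = v∈

    position-injective : ∀ {vs u v} → Positions vs → u ∈ vs → v ∈ vs → pos u ≡ pos v → u ≡ v
    position-injective ps       (here refl) (here refl) _  = refl
    position-injective ps       (here refl) (there v∈)  eq = contradiction (position-< ps v∈) (<-irrefl (sym eq))
    position-injective ps       (there u∈)  (here refl) eq = contradiction (position-< ps u∈) (<-irrefl eq)
    position-injective (_ ∷ ps) (there u∈)  (there v∈)  eq = position-injective ps u∈ v∈ eq

    -- The recursion goes back to the moment at which `v` was visited. Relative to the vertices
    -- visited before it, `v` is unvisited and serves as the trivial walk in `visited-clique`.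
    earlier-clique : Chordal G → ∀ {vs} → MaxCardinality vs → Unique vs → Positions vs →
                     ∀ {v a b} → v ∈ vs → a ∈ vs → b ∈ vs → pos a < pos v → pos b < pos v →
                     Edge G a v → Edge G b v → a ≢ b → Edge G a b
    earlier-clique ch (_ ∷ mc) u@(_ ∷ u′) ps (here refl) a∈ b∈ a<v b<v av bv a≢b =
      visited-clique ch mc u′ (earlier-∈ ps a∈ a<v) (earlier-∈ ps b∈ b<v) a≢b av v∉ ε v∉ (Edge-sym G bv)
      where v∉ = Unique[x∷xs]⇒x∉xs u
    earlier-clique ch (_ ∷ mc) (_ ∷ u) ps@(_ ∷ ps′) (there v∈) a∈ b∈ a<v b<v =
      earlier-clique ch mc u ps′ v∈ (earlier-∈ ps a∈ (<-trans a<v v<x)) (earlier-∈ ps b∈ (<-trans b<v v<x)) a<v b<v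
      where v<x = position-< ps v∈

    maxCardinality⇒perfectElimination : Chordal G → ∀ {vs} → MaxCardinality vs → Unique vs → Positions vs →
                                        (∀ v → v ∈ vs) → PerfectElimination pos
    maxCardinality⇒perfectElimination ch mc u ps all = record
      { injective = position-injective ps (all _) (all _)
      ; clique    = earlier-clique ch mc u ps (all _) (all _) (all _)
      }

-- Independent dominating sets of claw-free graphs

  Nbr : Fin n → Fin n → Set
  Nbr v y = v ≡ y ⊎ Edge G y v

  nbr? : ∀ v y → Dec (Nbr v y)
  nbr? v y = (v Fin.≟ y) ⊎-dec edge? G y v

  IndependentList : List (Fin n) → Set
  IndependentList xs = ∀ {u v} → u ∈ xs → v ∈ xs → ¬ Edge G u v

  Dominated : List (Fin n) → Fin n → Set
  Dominated xs v = Any (Nbr v) xs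

  dominated? : ∀ xs v → Dec (Dominated xs v)
  dominated? xs v = any? (nbr? v) xs

  lose : ∀ {xs v u} → u ∈ xs → Nbr v u → Dominated xs v
  lose (here refl) p = here p
  lose (there u∈)  p = there (lose u∈ p)

  find : ∀ {xs v} → Dominated xs v → ∃[ u ] u ∈ xs × Nbr v u
  find (here p) = _ , here refl , p
  find (there d) with find d
  ... | u , u∈ , p = u , there u∈ , p

  extend-independent : ∀ {x xs} → IndependentList xs → ¬ Dominated xs x → IndependentList (x ∷ xs)
  extend-independent ind nd (here refl) (here refl) e = Edge-irrefl G e
  extend-independent ind nd (here refl) (there v∈)  e = nd (lose v∈ (inj₂ (Edge-sym G e)))
  extend-independent ind nd (there u∈)  (here refl) e = nd (lose u∈ (inj₂ e))
  extend-independent ind nd (there u∈)  (there v∈)  e = ind u∈ v∈ e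

  extend-unique : ∀ {x xs} → Unique xs → ¬ Dominated xs x → Unique (x ∷ xs)
  extend-unique u nd = ∉⇒Unique (λ x∈ → nd (lose x∈ (inj₁ refl))) u

  -- `covers` speaks of the closed neighbourhoods of the listed vertices instead of the whole graph;
  -- so it makes sense for every part of a dominating set and allows recursion on the list.
  record IndependentCover (ds : List (Fin n)) : Set where
    field
      list        : List (Fin n)
      unique      : Unique list
      independent : IndependentList list
      shorter     : length list ≤ length ds
      covers      : ∀ {d v} → d ∈ ds → Nbr v d → Dominated list v

  -- If d is adjacent to s in the independent set, then the neighbours of d
  -- that are not yet dominated form a clique, by claw-freeness.
  independentCover : ClawFree G → ∀ ds → IndependentCover ds
  independentCover clawFree [] = record
    { list = [] ; unique = [] ; independent = λ () ; shorter = z≤n ; covers = λ () }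
  independentCover clawFree (d ∷ ds) = go (dominated? list d)
    where
    open IndependentCover (independentCover clawFree ds)

    add : ∀ x → ¬ Dominated list x → (∀ {v} → Nbr v d → Dominated (x ∷ list) v) → IndependentCover (d ∷ ds)
    add x nd cov = record
      { list = x ∷ list ; unique = extend-unique unique nd ; independent = extend-independent independent nd
      ; shorter = s≤s shorter
      ; covers = λ { (here refl) p → cov p ; (there d∈) p → there (covers d∈ p) } }

    private-neighbour? : Dec (∃[ y ] Nbr y d × ¬ Dominated list y)
    private-neighbour? = Fin.any? λ y → nbr? y d ×-dec ¬? (dominated? list y)

    go : Dec (Dominated list d) → IndependentCover (d ∷ ds)
    go (no nd) = add d nd here
    go (yes dom) with private-neighbour?
    ... | no none = record
      { list = list ; unique = unique ; independent = independent ; shorter = m≤n⇒m≤1+n shorter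
      ; covers = λ { (here refl) p → decidable-stable (dominated? list _) λ nd → none (_ , p , nd)
                   ; (there d∈) p → covers d∈ p } }
    ... | yes (y , yd , ndy) = add y ndy cov
      where
      cov : ∀ {v} → Nbr v d → Dominated (y ∷ list) v
      cov {v} vd = decidable-stable (dominated? (y ∷ list) v) λ nd → claw nd (find dom) yd vd
        where
        claw : ¬ Dominated (y ∷ list) v → (∃[ s ] s ∈ list × Nbr d s) → Nbr y d → Nbr v d → ⊥
        claw nd _ (inj₁ refl) _ = ndy dom
        claw nd _ _ (inj₁ refl) = nd (there dom)
        claw nd (s , s∈ , inj₁ refl) yd _ = ndy (lose s∈ yd)
        claw nd (s , s∈ , inj₂ sd) (inj₂ dy) (inj₂ dv) =
          clawFree dy dv (Edge-sym G sd)
            (λ { refl → nd (here (inj₁ refl)) }) (λ { refl → nd (there (lose s∈ (inj₁ refl))) })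
            (λ { refl → ndy (lose s∈ (inj₁ refl)) })
            (λ yv → nd (here (inj₂ yv))) (λ vs → nd (there (lose s∈ (inj₂ (Edge-sym G vs)))))
            (λ ys → ndy (lose s∈ (inj₂ (Edge-sym G ys))))

-- The primal–dual algorithm

  module _ {pos : Fin n → ℕ} (pe : PerfectElimination pos) where
    open PerfectElimination pe

    -- For fixed `z` this is the clique that `z` forms with its remaining neighbours at the moment
    -- of its elimination.
    Up : Fin n → Fin n → Set
    Up z v = z ≡ v ⊎ (Edge G z v × pos v < pos z)

    up? : ∀ z v → Dec (Up z v)
    up? z v = (z Fin.≟ v) ⊎-dec (edge? G z v ×-dec (pos v <? pos z))

    up-clique : ∀ {z a b} → Up z a → Up z b → a ≡ b ⊎ Edge G a b
    up-clique (inj₁ refl)       (inj₁ refl)       = inj₁ refl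
    up-clique (inj₁ refl)       (inj₂ (zb , _))   = inj₂ zb
    up-clique (inj₂ (za , _))   (inj₁ refl)       = inj₂ (Edge-sym G za)
    up-clique {a = a} {b} (inj₂ (za , a<z)) (inj₂ (zb , b<z)) with a Fin.≟ b
    ... | yes a≡b = inj₁ a≡b
    ... | no  a≢b = inj₂ (clique a<z b<z (Edge-sym G za) (Edge-sym G zb) a≢b)

    -- The state after the vertices of position greater than k have been
    -- processed: M holds the marked vertices, Y and Z the support of the
    -- dual solution.
    record Marking (k : ℕ) (Y Z M : List (Fin n)) : Set where
      field
        Y⊆M      : ∀ {v} → v ∈ Y → v ∈ M
        Z⊆M      : ∀ {v} → v ∈ Z → v ∈ M
        M-late   : ∀ {v} → v ∈ M → k < pos v
        Y-unique : Unique Y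
        Y-last   : ∀ {i j} → i ∈ Y → j ∈ M → Edge G i j → pos j < pos i
        tight    : ∀ {v} → v ∈ M → count (nbr? v) Y ≡ suc (count (λ z → up? z v) Z)
        loose    : ∀ {v} → k < pos v → v ∉ M →
                   count (nbr? v) Y ≤ count (λ z → up? z v) Z
                   ⊎ (∃[ y ] y ∈ Y × Edge G y v × pos y < pos v)
                     × count (nbr? v) Y ≤ suc (count (λ z → up? z v) Z)
        reached  : ∀ {v} → k < pos v → ∃[ j ] j ∈ M × Up j v

      -- Of two adjacent elements of `Y`, each would have to precede the other.
      Y-independent : IndependentList Y
      Y-independent i∈ j∈ ij = <-asym (Y-last i∈ (Y⊆M j∈) ij) (Y-last j∈ (Y⊆M i∈) (Edge-sym G ij))

    no-marking : ∀ {k} → (∀ v → pos v ≤ k) → Marking k [] [] []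
    no-marking pos≤ = record
      { Y⊆M = λ () ; Z⊆M = λ () ; M-late = λ () ; Y-unique = [] ; Y-last = λ () ; tight = λ ()
      ; loose = λ k<v _ → contradiction (pos≤ _) (λ v≤k → <-irrefl refl (<-≤-trans k<v v≤k))
      ; reached = λ k<v → contradiction (pos≤ _) (λ v≤k → <-irrefl refl (<-≤-trans k<v v≤k)) }

    module _ {k Y Z M} (m : Marking (suc k) Y Z M) {x} (x≡ : pos x ≡ suc k) where
      open Marking m

      later : ∀ {v} → k < pos v → v ≢ x → suc k < pos v
      later k<v v≢x = ≤∧≢⇒< k<v (λ eq → v≢x (injective (trans (sym eq) (sym x≡))))

      x<M : ∀ {v} → v ∈ M → pos x < pos v
      x<M {v} v∈ = subst (_< pos v) (sym x≡) (M-late v∈)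

      x<late : ∀ {v} → suc k < pos v → pos x < pos v
      x<late {v} = subst (_< pos v) (sym x≡)

      x∉M : x ∉ M
      x∉M x∈ = <-irrefl refl (x<M x∈)

      k<x : k < pos x
      k<x = subst (k <_) (sym x≡) (n<1+n k)

      M-late′ : ∀ {v} → v ∈ x ∷ M → k < pos v
      M-late′ (here refl) = k<x
      M-late′ (there v∈)  = <-trans (n<1+n k) (M-late v∈)

      count-nbr : ∀ L → (∀ {v} → v ∈ L → v ∈ M) → count (nbr? x) L ≡ neighbourCount x L
      count-nbr L L⊆M = count-cong (nbr? x) (λ u → edge? G u x) L
        (λ { v∈ (inj₁ refl) → contradiction (L⊆M v∈) x∉M ; v∈ (inj₂ e) → e }) (λ _ → inj₂)

      count-up : ∀ L → (∀ {v} → v ∈ L → v ∈ M) → count (λ z → up? z x) L ≡ neighbourCount x L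
      count-up L L⊆M = count-cong (λ z → up? z x) (λ u → edge? G u x) L
        (λ { v∈ (inj₁ refl) → contradiction (L⊆M v∈) x∉M ; v∈ (inj₂ (e , _)) → e })
        (λ v∈ e → inj₂ (e , x<M (L⊆M v∈)))

      late-cases : ∀ {v} → k < pos v → v ≡ x ⊎ suc k < pos v
      late-cases {v} k<v with v Fin.≟ x
      ... | yes v≡x = inj₁ v≡x
      ... | no  v≢x = inj₂ (later k<v v≢x)

      reached-marked : ∀ {v} → k < pos v → ∃[ j ] j ∈ x ∷ M × Up j v
      reached-marked k<v with late-cases k<v
      ... | inj₁ refl = x , here refl , inj₁ refl
      ... | inj₂ k<v′ = let j , j∈ , up = reached k<v′ in j , there j∈ , up

      -- No marked vertex is adjacent to `x`, so the tight equations stay as they are; among the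
      -- processed vertices only unmarked ones can gain a neighbour in `Y`.
      mark-Y : (∀ {j} → j ∈ M → ¬ Edge G j x) → Marking k (x ∷ Y) Z (x ∷ M)
      mark-Y isolated = record
        { Y⊆M = λ { (here refl) → here refl ; (there v∈) → there (Y⊆M v∈) }
        ; Z⊆M = there ∘ Z⊆M
        ; M-late = M-late′
        ; Y-unique = ∉⇒Unique (x∉M ∘ Y⊆M) Y-unique
        ; Y-last = λ { (here refl) (here refl) e → contradiction e (Edge-irrefl G)
                     ; (here refl) (there j∈) e → contradiction (Edge-sym G e) (isolated j∈)
                     ; (there i∈) (here refl) e → contradiction e (isolated (Y⊆M i∈))
                     ; (there i∈) (there j∈) e → Y-last i∈ j∈ e }
        ; tight = tight′
        ; loose = loose′
        ; reached = reached-marked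
        }
        where
        open ≡-Reasoning

        tight′ : ∀ {v} → v ∈ x ∷ M → count (nbr? v) (x ∷ Y) ≡ suc (count (λ z → up? z v) Z)
        tight′ (here refl) = begin
          bit (nbr? x x) + count (nbr? x) Y ≡⟨ cong₂ _+_ (bit-yes (nbr? x x) (inj₁ refl))
                                                 (trans (count-nbr Y Y⊆M) (count-none (λ u → edge? G u x) Y (isolated ∘ Y⊆M))) ⟩
          1                                 ≡⟨ cong suc (trans (count-up Z Z⊆M) (count-none (λ u → edge? G u x) Z (isolated ∘ Z⊆M))) ⟨
          suc (count (λ z → up? z x) Z)     ∎
        tight′ {v} (there v∈) = begin
          bit (nbr? v x) + count (nbr? v) Y ≡⟨ cong (_+ _) (bit-no (nbr? v x)
                                                 λ { (inj₁ refl) → x∉M v∈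
                                                   ; (inj₂ e) → isolated v∈ (Edge-sym G e) }) ⟩
          count (nbr? v) Y                  ≡⟨ tight v∈ ⟩
          suc (count (λ z → up? z v) Z)     ∎

        loose′ : ∀ {v} → k < pos v → v ∉ x ∷ M →
                 count (nbr? v) (x ∷ Y) ≤ count (λ z → up? z v) Z
                 ⊎ (∃[ y ] y ∈ x ∷ Y × Edge G y v × pos y < pos v)
                   × count (nbr? v) (x ∷ Y) ≤ suc (count (λ z → up? z v) Z)
        loose′ {v} k<v v∉ = go (nbr? v x)
          where
          k<v′ = later k<v (v∉ ∘ here)

          Loose : ℕ → Set
          Loose b = b + count (nbr? v) Y ≤ count (λ z → up? z v) Z
                    ⊎ (∃[ y ] y ∈ x ∷ Y × Edge G y v × pos y < pos v)
                      × b + count (nbr? v) Y ≤ suc (count (λ z → up? z v) Z)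

          go : Dec (Nbr v x) → Loose (bit (nbr? v x))
          go (no ¬vx) = subst Loose (sym (bit-no (nbr? v x) ¬vx))
            (Sum.map id (λ ((y , y∈ , r) , le) → (y , there y∈ , r) , le) (loose k<v′ (v∉ ∘ there)))
          go (yes (inj₁ refl)) = contradiction (here refl) v∉
          go (yes (inj₂ xv)) with loose k<v′ (v∉ ∘ there)
          ... | inj₁ le = subst Loose (sym (bit-yes (nbr? v x) (inj₂ xv)))
                            (inj₂ ((x , here refl , xv , x<late k<v′) , s≤s le))
          -- A second gain is impossible: `x` and `y` are both earlier neighbours of `v` and hence
          -- adjacent, but `x` has no marked neighbour. This is why `loose` records such a `y` as
          -- soon as the bound is exceeded.
          ... | inj₂ ((y , y∈ , yv , y<v) , _) =
            contradiction (clique y<v (x<late k<v′) yv xv λ { refl → x∉M (Y⊆M y∈) }) (isolated (Y⊆M y∈))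

      mark-E : neighbourCount x Y ≡ suc (neighbourCount x Z) → Marking k Y Z (x ∷ M)
      mark-E eq = record
        { Y⊆M = there ∘ Y⊆M
        ; Z⊆M = there ∘ Z⊆M
        ; M-late = M-late′
        ; Y-unique = Y-unique
        ; Y-last = λ { i∈ (here refl) _ → x<M (Y⊆M i∈) ; i∈ (there j∈) e → Y-last i∈ j∈ e }
        ; tight = λ { (here refl) → trans (count-nbr Y Y⊆M) (trans eq (cong suc (sym (count-up Z Z⊆M))))
                    ; (there v∈) → tight v∈ }
        ; loose = λ k<v v∉ → loose (later k<v (v∉ ∘ here)) (v∉ ∘ there)
        ; reached = reached-marked
        }

      -- Putting `x` into `Z` adds one to the right-hand side of `x` itself, which cancels the
      -- second unit of excess. Apart from `x`, only vertices of smaller position are affected, and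
      -- none of these has been processed.
      mark-Z : neighbourCount x Y ≡ suc (suc (neighbourCount x Z)) → Marking k Y (x ∷ Z) (x ∷ M)
      mark-Z eq = record
        { Y⊆M = there ∘ Y⊆M
        ; Z⊆M = λ { (here refl) → here refl ; (there v∈) → there (Z⊆M v∈) }
        ; M-late = M-late′
        ; Y-unique = Y-unique
        ; Y-last = λ { i∈ (here refl) _ → x<M (Y⊆M i∈) ; i∈ (there j∈) e → Y-last i∈ j∈ e }
        ; tight = λ { (here refl) → trans (count-nbr Y Y⊆M) (trans eq (cong suc (sym
                        (cong₂ _+_ (bit-yes (up? x x) (inj₁ refl)) (count-up Z Z⊆M)))))
                    ; (there v∈) → trans (tight v∈) (cong suc (sym (unchanged (M-late v∈)))) }
        ; loose = λ {v} k<v v∉ → let k<v′ = later k<v (v∉ ∘ here) in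
                  subst (λ c → count (nbr? v) Y ≤ c ⊎ (∃[ y ] y ∈ Y × Edge G y v × pos y < pos v) × count (nbr? v) Y ≤ suc c)
                        (sym (unchanged k<v′)) (loose k<v′ (v∉ ∘ there))
        ; reached = reached-marked
        }
        where
        unchanged : ∀ {v} → suc k < pos v → count (λ z → up? z v) (x ∷ Z) ≡ count (λ z → up? z v) Z
        unchanged {v} k<v = cong (_+ _) (bit-no (up? x v)
          λ { (inj₁ refl) → <-irrefl refl (x<late k<v) ; (inj₂ (_ , v<x)) → <-asym v<x (x<late k<v) })

      -- The inequality puts `x` into the first alternative of `loose`, which leaves room for one
      -- later neighbour in `Y`. The marked neighbour `j`, whose position is greater, is what
      -- `reached` needs for `x`.
      leave-unmarked : neighbourCount x Y ≤ neighbourCount x Z → (∃[ j ] j ∈ M × Edge G j x) →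
                       Marking k Y Z M
      leave-unmarked le (j , j∈ , jx) = record
        { Y⊆M = Y⊆M ; Z⊆M = Z⊆M ; M-late = M-late′ ∘ there ; Y-unique = Y-unique ; Y-last = Y-last ; tight = tight
        ; loose = λ k<v v∉ → loose′ (late-cases k<v) v∉
        ; reached = λ k<v → reached′ (late-cases k<v)
        }
        where
        loose′ : ∀ {v} → v ≡ x ⊎ suc k < pos v → v ∉ M → _
        loose′ (inj₁ refl) _  = inj₁ (subst₂ _≤_ (sym (count-nbr Y Y⊆M)) (sym (count-up Z Z⊆M)) le)
        loose′ (inj₂ k<v)  v∉ = loose k<v v∉

        reached′ : ∀ {v} → v ≡ x ⊎ suc k < pos v → ∃[ j ] j ∈ M × Up j v
        reached′ (inj₁ refl) = j , j∈ , inj₂ (jx , x<M j∈)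
        reached′ (inj₂ k<v)  = reached k<v

    -- Three pairwise nonadjacent neighbours would form a claw.
    Y-neighbours≤2 : ClawFree G → ∀ {k Y Z M} → Marking k Y Z M → ∀ x → neighbourCount x Y ≤ 2
    Y-neighbours≤2 clawFree {Y = Y} m x = three (λ u → edge? G u x) Y-unique
        λ a∈ b∈ c∈ a≢b b≢c a≢c ax bx cx →
          clawFree (Edge-sym G ax) (Edge-sym G bx) (Edge-sym G cx) a≢b b≢c a≢c
                   (Y-independent a∈ b∈) (Y-independent b∈ c∈) (Y-independent a∈ c∈)
      where
      open Marking m
      one : ∀ {P : Fin n → Set} (P? : ∀ v → Dec (P v)) {xs} → Unique xs →
            (∀ {a b} → a ∈ xs → b ∈ xs → a ≢ b → P a → P b → ⊥) → count P? xs ≤ 1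
      one P? u h = count≤1 P? u λ {a} {b} a∈ b∈ p q → decidable-stable (a Fin.≟ b) λ a≢b → h a∈ b∈ a≢b p q
      three : ∀ {P : Fin n → Set} (P? : ∀ v → Dec (P v)) {xs} → Unique xs →
              (∀ {a b c} → a ∈ xs → b ∈ xs → c ∈ xs → a ≢ b → b ≢ c → a ≢ c → P a → P b → P c → ⊥) →
              count P? xs ≤ 2
      three P? {[]} _ _ = z≤n
      three P? {x ∷ xs} u@(_ ∷ u′) h with P? x
      ... | no _  = three P? u′ λ a∈ b∈ c∈ → h (there a∈) (there b∈) (there c∈)
      ... | yes p = s≤s (one P? u′ λ a∈ b∈ a≢b pa pb →
        h (here refl) (there a∈) (there b∈) (λ { refl → Unique[x∷xs]⇒x∉xs u a∈ }) a≢b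
          (λ { refl → Unique[x∷xs]⇒x∉xs u b∈ }) p pa pb)

    module _ {Y Z M} (m : Marking 0 Y Z M) (pos>0 : ∀ v → 0 < pos v) where
      open Marking m

      slack : ∀ v → count (nbr? v) Y ≤ suc (count (λ z → up? z v) Z)
      slack v with v ∈? M
      ... | yes v∈ = ≤-reflexive (tight v∈)
      ... | no  v∉ with loose (pos>0 v) v∉
      ...   | inj₁ le       = m≤n⇒m≤1+n le
      ...   | inj₂ (_ , le) = le

      module _ {S} (S⊆M : ∀ {v} → v ∈ S → v ∈ M) (hit : ∀ {v} → v ∈ M → ∃[ w ] w ∈ S × Up v w) where

        -- Some marked `j` has `v` in its clique, and the selected `w` that hits this clique is
        -- therefore equal or adjacent to `v`.
        maximal⇒dominating : ∀ v → Dominated S v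
        maximal⇒dominating v with reached (pos>0 v)
        ... | j , j∈ , jv with hit j∈
        ...   | w , w∈ , jw with up-clique jv jw
        ...     | inj₁ v≡w = lose w∈ (inj₁ v≡w)
        ...     | inj₂ vw  = lose w∈ (inj₂ (Edge-sym G vw))

        maximal⇒minimum : Unique S → IndependentList S → ∀ {I} → Unique I → IndependentList I →
                          (∀ v → Dominated I v) → length S ≤ length I
        maximal⇒minimum uS indS {I} uI indI domI = +-cancelʳ-≤ (length Z) _ _
          (≤-trans
            (complementary-slackness S Y Z r u (tight ∘ S⊆M) once
              (λ {z} z∈ → let w , w∈ , zw = hit (Z⊆M z∈) in count-some (up? z) w∈ zw))
            (weak-duality I Y Z r u (λ {v} _ → slack v)
              (λ {i} _ → let w , w∈ , iw = find (domI i) in count-some (λ v → nbr? v i) w∈ (nbr-sym iw))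
              (λ {z} _ → count≤1 (up? z) uI λ a∈ b∈ za zb → clique⇒≡ indI a∈ b∈ (up-clique za zb))))
          where
          r u : Fin n → Fin n → ℕ
          r v i = bit (nbr? v i)
          u z v = bit (up? z v)

          nbr-sym : ∀ {a b} → Nbr a b → Nbr b a
          nbr-sym = Sum.map sym (Edge-sym G)

          clique⇒≡ : ∀ {xs} → IndependentList xs → ∀ {a b} → a ∈ xs → b ∈ xs → a ≡ b ⊎ Edge G a b → a ≡ b
          clique⇒≡ ind a∈ b∈ (inj₁ a≡b) = a≡b
          clique⇒≡ ind a∈ b∈ (inj₂ ab)  = contradiction ab (ind a∈ b∈)

          -- By `Y-last`, the marked neighbours of `i` all precede it. So the selected vertices in
          -- the closed neighbourhood of `i` lie in a clique, and there is at most one of them.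
          nbr⇒up : ∀ {i a} → i ∈ Y → a ∈ S → Nbr a i → Up i a
          nbr⇒up i∈ a∈ (inj₁ a≡i) = inj₁ (sym a≡i)
          nbr⇒up i∈ a∈ (inj₂ ia)  = inj₂ (ia , Y-last i∈ (S⊆M a∈) ia)

          once : ∀ {i} → i ∈ Y → ∑ S (λ v → r v i) ≤ 1
          once {i} i∈ = count≤1 (λ v → nbr? v i) uS λ a∈ b∈ ai bi →
            clique⇒≡ indS a∈ b∈ (up-clique (nbr⇒up i∈ a∈ ai) (nbr⇒up i∈ b∈ bi))

-- Subsets as lists, and optimality of the greedy set

elements : ∀ {n} → Subset n → List (Fin n)
elements []          = []
elements (true ∷ p)  = zero ∷ map suc (elements p)
elements (false ∷ p) = map suc (elements p)

length-elements : ∀ {n} (p : Subset n) → length (elements p) ≡ ∣ p ∣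
length-elements []          = refl
length-elements (true ∷ p)  = cong suc (trans (length-map suc (elements p)) (length-elements p))
length-elements (false ∷ p) = trans (length-map suc (elements p)) (length-elements p)

∈-elements⁺ : ∀ {n} {p : Subset n} {x} → x ∈ˢ p → x ∈ elements p
∈-elements⁺ {p = true ∷ p}  hereᵛ       = here refl
∈-elements⁺ {p = true ∷ p}  (thereᵛ x∈) = there (∈-map⁺ suc (∈-elements⁺ x∈))
∈-elements⁺ {p = false ∷ p} (thereᵛ x∈) = ∈-map⁺ suc (∈-elements⁺ x∈)

∈-elements⁻ : ∀ {n} {p : Subset n} {x} → x ∈ elements p → x ∈ˢ p
∈-elements⁻ {p = true ∷ p}  (here refl) = hereᵛ
∈-elements⁻ {p = true ∷ p}  (there x∈)  with ∈-map⁻ suc x∈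
... | _ , y∈ , refl = thereᵛ (∈-elements⁻ y∈)
∈-elements⁻ {p = false ∷ p} x∈ with ∈-map⁻ suc x∈
... | _ , y∈ , refl = thereᵛ (∈-elements⁻ y∈)

elements-unique : ∀ {n} (p : Subset n) → Unique (elements p)
elements-unique []          = []
elements-unique (true ∷ p)  =
  ∉⇒Unique (λ z∈ → case-zero (∈-map⁻ suc z∈)) (Unique-map⁺ Fin.suc-injective (elements-unique p))
  where
  case-zero : ∀ {n} {xs : List (Fin n)} → ¬ (∃[ y ] y ∈ xs × zero ≡ suc y)
  case-zero (_ , _ , ())
elements-unique (false ∷ p) = Unique-map⁺ Fin.suc-injective (elements-unique p)

module _ {n} {G : Graph n} (clawFree : ClawFree G) {pos : Fin n → ℕ} (pe : PerfectElimination G pos)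
         (pos>0 : ∀ v → 0 < pos v) {Y Z M} (m : Marking G pe 0 Y Z M) where

  greedy-optimal : ∀ {S} → (∀ {v} → v ∈ S → v ∈ M) → IndependentList G S →
                   (∀ {v} → v ∈ M → ∃[ w ] w ∈ S × Up G pe v w) →
                   ∀ (D : Subset n) → (∀ {v} → v ∈ˢ D → v ∈ S) → (∀ {v} → v ∈ S → v ∈ˢ D) →
                   IndependentMinimumDominating G D
  greedy-optimal {S} S⊆M ind hit D D⊆S S⊆D =
    (λ u v u∈ v∈ → ind (D⊆S u∈) (D⊆S v∈)) , dominating , minimum
    where
    dominating : Dominating G D
    dominating v with find G (maximal⇒dominating G pe m pos>0 S⊆M hit v)
    ... | u , u∈ , inj₁ refl = inj₁ (S⊆D u∈)
    ... | u , u∈ , inj₂ uv   = inj₂ (u , S⊆D u∈ , Edge-sym G uv)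

    minimum : ∀ D′ → Dominating G D′ → ∣ D ∣ ≤ ∣ D′ ∣
    minimum D′ dom = begin
      ∣ D ∣                ≡⟨ length-elements D ⟨
      length (elements D)  ≤⟨ maximal⇒minimum G pe m pos>0 {elements D}
                                (S⊆M ∘ D⊆S ∘ ∈-elements⁻)
                                (λ v∈ → let w , w∈ , up = hit v∈ in w , ∈-elements⁺ (S⊆D w∈) , up)
                                (elements-unique D)
                                (λ u∈ v∈ → ind (D⊆S (∈-elements⁻ u∈)) (D⊆S (∈-elements⁻ v∈)))
                                unique independent dominated ⟩
      length list          ≤⟨ shorter ⟩
      length (elements D′) ≡⟨ length-elements D′ ⟩
      ∣ D′ ∣               ∎
      where
      open ≤-Reasoning
      open IndependentCover (independentCover G clawFree (elements D′))
      dominated : ∀ v → Dominated G list v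
      dominated v with dom v
      ... | inj₁ v∈             = covers (∈-elements⁺ v∈) (inj₁ refl)
      ... | inj₂ (u , u∈ , vu) = covers (∈-elements⁺ u∈) (inj₂ (Edge-sym G vu))

-- The degree sum and the number of edges

∑-map : {A B : Set} (f : A → B) (g : B → ℕ) → ∀ xs → ∑ (map f xs) g ≡ ∑ xs (g ∘ f)
∑-map f g []       = refl
∑-map f g (x ∷ xs) = cong (g (f x) +_) (∑-map f g xs)

count-cartesianProduct : {A B : Set} {P : A × B → Set} (P? : ∀ p → Dec (P p)) → ∀ xs ys →
                         count P? (cartesianProduct xs ys) ≡ ∑ xs (λ x → count (λ y → P? (x , y)) ys)
count-cartesianProduct P? []       ys = refl
count-cartesianProduct P? (x ∷ xs) ys = trans
  (∑-++ (map (x ,_) ys) _ (bit ∘ P?))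
  (cong₂ _+_ (∑-map (x ,_) (bit ∘ P?) ys) (count-cartesianProduct P? xs ys))

length-filter≡count : {A : Set} {P : A → Set} (P? : ∀ x → Dec (P x)) → ∀ xs → length (filter P? xs) ≡ count P? xs
length-filter≡count P? []       = refl
length-filter≡count P? (x ∷ xs) with P? x
... | yes _ = cong suc (length-filter≡count P? xs)
... | no  _ = length-filter≡count P? xs

module _ {n} {G : Graph n} (L : AdjacencyLists G) where
  open AdjacencyLists L

  degree : Fin n → ℕ
  degree v = length (neighbours v)

  -- Each listed adjacency is charged to the orientation with the smaller end first, which is how
  -- `edgeCount` lists the edges.
  handshake : ∑ (allFin n) degree ≤ edgeCount G + edgeCount G
  handshake = begin
    ∑ V degree                                            ≤⟨ ∑-mono V (λ {v} _ → degree≤ v) ⟩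
    ∑ V (λ v → count (edge? G v) V)                       ≤⟨ ∑-mono V (λ _ → ∑-mono V λ _ → orient _ _) ⟩
    ∑ V (λ v → ∑ V (λ w → forward v w + forward w v))               ≡⟨ ∑-cong V (λ _ → ∑-+ V _ _) ⟩
    ∑ V (λ v → ∑ V (forward v) + ∑ V (flip forward v))              ≡⟨ ∑-+ V _ _ ⟩
    ∑ V (λ v → ∑ V (forward v)) + ∑ V (λ v → ∑ V (flip forward v))  ≡⟨ cong (∑ V (λ v → ∑ V (forward v)) +_) (∑-swap V V (flip forward)) ⟩
    ∑ V (λ v → ∑ V (forward v)) + ∑ V (λ v → ∑ V (forward v))       ≡⟨ cong₂ _+_ edges edges ⟨
    edgeCount G + edgeCount G                             ∎
    where
    open ≤-Reasoning
    V = allFin n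

    forward? : ∀ p → Dec (proj₁ p <ᶠ proj₂ p × Edge G (proj₁ p) (proj₂ p))
    forward? (u , v) = (u Fin.<? v) ×-dec T? (Graph.adj G u v)

    forward : Fin n → Fin n → ℕ
    forward u v = bit (forward? (u , v))

    edges : edgeCount G ≡ ∑ V (λ v → ∑ V (forward v))
    edges = trans (length-filter≡count forward? (cartesianProduct V V)) (count-cartesianProduct forward? V V)

    degree≤ : ∀ v → degree v ≤ count (edge? G v) V
    degree≤ v = begin
      degree v                        ≡⟨ count-all (edge? G v) (neighbours v) (Equivalence.to (complete v _)) ⟨
      count (edge? G v) (neighbours v) ≤⟨ ∑-⊆ _ (unique v) (λ _ → ∈-allFin _) ⟩
      count (edge? G v) V             ∎

    orient : ∀ v w → bit (edge? G v w) ≤ forward v w + forward w v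
    orient v w = go (edge? G v w)
      where
      go : (d : Dec (Edge G v w)) → bit d ≤ forward v w + forward w v
      go (no _) = z≤n
      go (yes vw) with Fin.<-cmp v w
      ... | tri< v<w _ _  = ≤-trans (≤-reflexive (sym (bit-yes (forward? (v , w)) (v<w , vw)))) (m≤m+n _ _)
      ... | tri≈ _ refl _ = contradiction vw (Edge-irrefl G)
      ... | tri> _ _ w<v  = ≤-trans (≤-reflexive (sym (bit-yes (forward? (w , v)) (w<v , Edge-sym G vw)))) (m≤n+m _ (forward v w))

-- Reasoning about programs

≡ᵇ-true : ∀ {m n} → (m ≡ᵇ n) ≡ true → m ≡ n
≡ᵇ-true {m} {n} eq = ≡ᵇ⇒≡ m n (subst T (sym eq) tt)

≡ᵇ-false : ∀ {m n} → (m ≡ᵇ n) ≡ false → m ≢ n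
≡ᵇ-false {m} {n} eq m≡n = subst T eq (≡⇒≡ᵇ m n m≡n)

≢⇒≡ᵇ-false : ∀ {m n} → m ≢ n → (m ≡ᵇ n) ≡ false
≢⇒≡ᵇ-false {m} {n} m≢n with m ≡ᵇ n in eq
... | false = refl
... | true  = contradiction (≡ᵇ-true eq) m≢n

≡ᵇ-refl : ∀ n → (n ≡ᵇ n) ≡ true
≡ᵇ-refl zero    = refl
≡ᵇ-refl (suc n) = ≡ᵇ-refl n

<ᵇ-true : ∀ {m n} → (m <ᵇ n) ≡ true → m < n
<ᵇ-true {m} {n} eq = <ᵇ⇒< m n (subst T (sym eq) tt)

<ᵇ-false : ∀ {m n} → (m <ᵇ n) ≡ false → ¬ m < n
<ᵇ-false {m} {n} eq m<n = subst T eq (<⇒<ᵇ m<n)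

module _ {A : Set} {f : ℕ → A} {i : ℕ} {a : A} where

  update-same : update f i a i ≡ a
  update-same rewrite ≡ᵇ-refl i = refl

  update-other : ∀ {j} → i ≢ j → update f i a j ≡ f j
  update-other i≢j rewrite ≢⇒≡ᵇ-false i≢j = refl

module _ {n : ℕ} {A : Set} {f : ℕ → A} {a : A} where

  update-toℕ : ∀ {v w : Fin n} → v ≢ w → update f (toℕ v) a (toℕ w) ≡ f (toℕ w)
  update-toℕ v≢w = update-other {f = f} (v≢w ∘ Fin.toℕ-injective)

-- A loop counts only once: its running time is bounded by the number of
-- iterations times its weight.
weight : Cmd → ℕ
weight skip                 = 1
weight (x ≔ e)              = suc (exprCost e)
weight (a ⟦ i ⟧≔ e)         = suc (exprCost i + exprCost e)
weight (c ⨾ d)              = weight c + weight d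
weight (IF b THEN c ELSE d) = testCost b + (weight c + weight d)
weight (WHILE b DO c)       = testCost b + weight c

-- All commands of a sequence share the parameter `m`: straight-line code costs at most its weight,
-- and loops account for the factor `suc m`. `Q` may itself assert a run of the remaining program,
-- which is how sequences are composed.
record Runs (m : ℕ) (c : Cmd) (s : Store) (Q : Store → Set) : Set where
  constructor halts
  field
    {time}  : ℕ
    {final} : Store
    run     : ⟨ c , s ⟩⇓[ time ] final
    bounded : time ≤ weight c * suc m
    result  : Q final

module _ {m : ℕ} where

  runs-skip : ∀ {s Q} → Q s → Runs m skip s Q
  runs-skip q = halts run-skip (m≤m*n 1 (suc m)) q

  runs-assign : ∀ {x e s} {Q : Store → Set} → Q (setVar s x (eval e s)) → Runs m (x ≔ e) s Q
  runs-assign {e = e} q = halts run-assign (m≤m*n (suc (exprCost e)) (suc m)) q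

  runs-write : ∀ {a i e s} {Q : Store → Set} → Q (setCell s a (eval i s) (eval e s)) → Runs m (a ⟦ i ⟧≔ e) s Q
  runs-write {i = i} {e} q = halts run-write (m≤m*n (suc (exprCost i + exprCost e)) (suc m)) q

  runs-seq : ∀ {c d s Q} → Runs m c s (λ s′ → Runs m d s′ Q) → Runs m (c ⨾ d) s Q
  runs-seq {c} {d} (halts r₁ b₁ (halts r₂ b₂ q)) =
    halts (run-seq r₁ r₂) (≤-trans (+-mono-≤ b₁ b₂) (≤-reflexive (sym (*-distribʳ-+ (suc m) (weight c) (weight d))))) q

  runs-if : ∀ {b c d s Q} → (test b s ≡ true → Runs m c s Q) → (test b s ≡ false → Runs m d s Q) →
            Runs m (IF b THEN c ELSE d) s Q
  runs-if {b} {c} {d} {s} {Q} t e = go (test b s) refl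
    where
    bound : ∀ {t A} → A ≤ weight c + weight d → t ≤ A * suc m →
            testCost b + t ≤ (testCost b + (weight c + weight d)) * suc m
    bound A≤ t≤ = ≤-trans (+-mono-≤ (m≤m*n (testCost b) (suc m)) (≤-trans t≤ (*-monoˡ-≤ (suc m) A≤)))
                          (≤-reflexive (sym (*-distribʳ-+ (suc m) (testCost b) (weight c + weight d))))
    go : ∀ v → test b s ≡ v → Runs m (IF b THEN c ELSE d) s Q
    go true eq with t eq
    ... | halts r le q = halts (run-then eq r) (bound (m≤m+n (weight c) (weight d)) le) q
    go false eq with e eq
    ... | halts r le q = halts (run-else eq r) (bound (m≤n+m (weight d) (weight c)) le) q

  runs-weaken : ∀ {m′ c s Q} → m ≤ m′ → Runs m c s Q → Runs m′ c s Q
  runs-weaken {c = c} m≤ (halts r b q) = halts r (≤-trans b (*-monoʳ-≤ (weight c) (s≤s m≤))) q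

  runs-map : ∀ {c s Q R} → Runs m c s Q → (∀ {s′} → Q s′ → R s′) → Runs m c s R
  runs-map (halts r b q) f = halts r b (f q)

-- The loop invariant carries a potential u; an iteration of cost
-- proportional to suc k has to release suc k units of it.
runs-while : ∀ {b c} {Q : Store → Set} (I : ℕ → Store → Set) →
             (∀ {u s} → I u s → test b s ≡ true →
               ∃[ k ] Runs k c s (λ s′ → ∃[ u′ ] suc k + u′ ≤ u × I u′ s′)) →
             (∀ {u s} → I u s → test b s ≡ false → Q s) →
             ∀ {u s} → I u s → Runs u (WHILE b DO c) s Q
runs-while {b} {c} {Q} I iterate exit {u} i = go u ≤-refl i
  where
  W = weight c
  K = testCost b + W

  bound : ∀ {t t′ k u u′} → t ≤ W * suc k → t′ ≤ K * suc u′ → suc k + u′ ≤ u →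
          testCost b + (t + t′) ≤ K * suc u
  bound {t} {t′} {k} {u} {u′} t≤ t′≤ le = begin
    testCost b + (t + t′)                        ≡⟨ +-assoc (testCost b) t t′ ⟨
    testCost b + t + t′                          ≤⟨ +-mono-≤ (+-mono-≤ (m≤m*n (testCost b) (suc k)) t≤) t′≤ ⟩
    testCost b * suc k + W * suc k + K * suc u′  ≡⟨ cong (_+ K * suc u′) (*-distribʳ-+ (suc k) (testCost b) W) ⟨
    K * suc k + K * suc u′                       ≡⟨ *-distribˡ-+ K (suc k) (suc u′) ⟨
    K * (suc k + suc u′)                         ≡⟨ cong (K *_) (+-suc (suc k) u′) ⟩
    K * suc (suc k + u′)                         ≤⟨ *-monoʳ-≤ K (s≤s le) ⟩
    K * suc u                                    ∎
    where open ≤-Reasoning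

  go : ∀ fuel {u s} → u ≤ fuel → I u s → Runs u (WHILE b DO c) s Q
  go fuel {u} {s} u≤ i with test b s in eq
  ... | false = halts (run-stop eq) (≤-trans (m≤m+n (testCost b) W) (m≤m*n K (suc u))) (exit i eq)
  ... | true with iterate i eq
  ...   | k , halts r t≤ (u′ , le , i′) = continue fuel u≤
    where
    continue : ∀ fuel → u ≤ fuel → Runs u (WHILE b DO c) s Q
    continue zero u≤ with () ← ≤-trans le u≤
    continue (suc fuel) u≤ with go fuel (≤-trans (m≤n+m u′ k) (≤-pred (≤-trans le u≤))) i′
    ... | halts r′ t′≤ q = halts (run-loop eq r r′) (bound t≤ t′≤ le) q

data Ascending {A : Set} (P : ℕ → A → Set) : ℕ → List A → Set where
  []  : ∀ {k} → Ascending P k []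
  _∷_ : ∀ {k x xs} → P k x → Ascending P (suc k) xs → Ascending P k (x ∷ xs)

module _ {A : Set} where

  ascending-shift : ∀ {P : ℕ → A → Set} {k xs} → Ascending (P ∘ suc) k xs → Ascending P (suc k) xs
  ascending-shift []       = []
  ascending-shift (p ∷ ps) = p ∷ ascending-shift ps

  ascending-++ : ∀ {P : ℕ → A → Set} {k} xs {ys} → Ascending P k xs → Ascending P (k + length xs) ys →
                 Ascending P k (xs ++ ys)
  ascending-++ {P} {k} []       {ys} []       qs = subst (λ j → Ascending P j ys) (+-identityʳ k) qs
  ascending-++ {P} {k} (x ∷ xs) {ys} (p ∷ ps) qs =
    p ∷ ascending-++ xs ps (subst (λ j → Ascending P j ys) (+-suc k (length xs)) qs)

-- The encoding of adjacency lists

module _ {n} (nbrs : Fin n → List (Fin n)) where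

  private
    entry : List ℕ → ℕ → ℕ
    entry l j = fromMaybe 0 (head (drop j l))

    lists : ∀ {m} → (Fin m → Fin n) → List (List ℕ)
    lists g = map (map toℕ ∘ nbrs) (tabulate g)

    offset : List (List ℕ) → ℕ → ℕ
    offset K i = length (concat (take i K))

    Stored : List ℕ → ℕ → List (Fin n) → Set
    Stored l = Ascending (λ e w → entry l e ≡ toℕ w)

    stored-prefix : ∀ ws {l} → Stored (map toℕ ws ++ l) 0 ws
    stored-prefix []       = []
    stored-prefix (w ∷ ws) = refl ∷ ascending-shift (stored-prefix ws)

    stored-++ : ∀ l {l′ k ws} → Stored l′ k ws → Stored (l ++ l′) (length l + k) ws
    stored-++ []      s = s
    stored-++ (_ ∷ l) s = ascending-shift (stored-++ l s)

    offset-∷ : ∀ l K i → offset (l ∷ K) (suc i) ≡ length l + offset K i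
    offset-∷ l K i = length-++ l

  stored : ∀ {m} (g : Fin m → Fin n) v → Stored (concat (lists g)) (offset (lists g) (toℕ v)) (nbrs (g v))
  stored g zero    = stored-prefix (nbrs (g zero))
  stored g (suc v) = subst (λ k → Stored (concat (lists g)) k _)
    (sym (offset-∷ (map toℕ (nbrs (g zero))) (lists (g ∘ suc)) (toℕ v)))
    (stored-++ (map toℕ (nbrs (g zero))) (stored (g ∘ suc) v))

  offset-suc : ∀ {m} (g : Fin m → Fin n) v →
               offset (lists g) (suc (toℕ v)) ≡ offset (lists g) (toℕ v) + length (nbrs (g v))
  offset-suc g zero = trans (offset-∷ (map toℕ (nbrs (g zero))) (lists (g ∘ suc)) 0)
    (trans (+-identityʳ _) (length-map toℕ (nbrs (g zero))))
  offset-suc g (suc v) = trans (offset-∷ l K (suc (toℕ v)))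
    (trans (cong (length l +_) (offset-suc (g ∘ suc) v))
    (trans (sym (+-assoc (length l) _ _))
           (cong (_+ length (nbrs (g (suc v)))) (sym (offset-∷ l K (toℕ v))))))
    where
    l = map toℕ (nbrs (g zero))
    K = lists (g ∘ suc)

-- Loops over the neighbours of a vertex

pattern nᵛ = 0
pattern iᵛ = 1
pattern jᵛ = 2
pattern vᵛ = 3
pattern eᵛ = 4
pattern wᵛ = 5
pattern fᵛ = 6

-- NM, NY, NZ and NS hold the numbers of marked neighbours, of neighbours in
-- the supports Y and Z, and of selected neighbours.
pattern OFF  = 0
pattern ADJ  = 1
pattern OUT  = 2
pattern ORD  = 3
pattern POS  = 4
pattern CNT  = 5
pattern HEAD = 6
pattern NEXT = 7
pattern VAL  = 8
pattern MARK = 9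
pattern NM   = 10
pattern NY   = 11
pattern NZ   = 12
pattern NS   = 13

each : Cmd → Cmd
each body = eᵛ ≔ OFF ⟦ var vᵛ ⟧ ⨾
            WHILE var eᵛ ≺ OFF ⟦ suc1 (var vᵛ) ⟧ DO (body ⨾ eᵛ ≔ suc1 (var eᵛ))

bump : ℕ → Cmd
bump a = each (a ⟦ ADJ ⟦ var eᵛ ⟧ ⟧≔ suc1 (a ⟦ ADJ ⟦ var eᵛ ⟧ ⟧))

module _ {n} {G : Graph n} (L : AdjacencyLists G) where
  open AdjacencyLists L

  record Input (n′ : ℕ) (off adj : ℕ → ℕ) : Set where
    field
      size≡ : n′ ≡ n
      off≡  : off ≡ arrays (encode L) OFF
      adj≡  : adj ≡ arrays (encode L) ADJ

  InputAt : Store → Set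
  InputAt s = Input (vars s nᵛ) (arrays s OFF) (arrays s ADJ)

  neighbours-stored : ∀ {n′ off adj} → Input n′ off adj → ∀ x →
                      Ascending (λ e w → adj e ≡ toℕ w) (off (toℕ x)) (neighbours x)
  neighbours-stored record { off≡ = refl ; adj≡ = refl } x = stored neighbours id x

  neighbours-end : ∀ {n′ off adj} → Input n′ off adj → ∀ x →
                   off (suc (toℕ x)) ≡ off (toℕ x) + degree L x
  neighbours-end record { off≡ = refl } x = offset-suc neighbours id x

  module _ {x : Fin n} (I : List (Fin n) → Store → Set)
           (stable : ∀ {ws s} e → I ws s → I ws (setVar s eᵛ e))
           (input  : ∀ {ws s} → I ws s → InputAt s × vars s vᵛ ≡ toℕ x)
           where

    private
      Loop : ℕ → Store → Set
      Loop u s = ∃[ ws ] length ws ≡ u × Ascending (λ e w → arrays s ADJ e ≡ toℕ w) (vars s eᵛ) ws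
                 × vars s eᵛ + length ws ≡ arrays s OFF (suc (vars s vᵛ)) × I ws s

    -- The list argument of `I` holds the neighbours still to be treated. Its length is the
    -- potential of the loop and also the distance of the pointer `eᵛ`, which the body has to
    -- preserve, from the end of the block.
    runs-each : ∀ {body s Q} →
                (∀ {w ws s} → I (w ∷ ws) s → arrays s ADJ (vars s eᵛ) ≡ toℕ w →
                  Runs 0 body s (λ s′ → vars s′ eᵛ ≡ vars s eᵛ × I ws s′)) →
                (∀ {s} → I [] s → Q s) → I (neighbours x) s →
                Runs (degree L x) (each body) s Q
    runs-each {body} {s} {Q} next finish i = runs-seq (runs-assign
      (runs-while Loop iterate exit (neighbours x , refl , start , end , stable _ i)))
      where
      in₀ = proj₁ (input i)
      v≡  = proj₂ (input i)

      start : Ascending (λ e w → arrays s ADJ e ≡ toℕ w) (arrays s OFF (vars s vᵛ)) (neighbours x)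
      start = subst (λ k → Ascending _ (arrays s OFF k) _) (sym v≡) (neighbours-stored in₀ x)

      end : arrays s OFF (vars s vᵛ) + degree L x ≡ arrays s OFF (suc (vars s vᵛ))
      end = subst (λ k → arrays s OFF k + degree L x ≡ arrays s OFF (suc k)) (sym v≡) (sym (neighbours-end in₀ x))

      iterate : ∀ {u s} → Loop u s → test (var eᵛ ≺ OFF ⟦ suc1 (var vᵛ) ⟧) s ≡ true →
                ∃[ k ] Runs k (body ⨾ eᵛ ≔ suc1 (var eᵛ)) s (λ s′ → ∃[ u′ ] suc k + u′ ≤ u × Loop u′ s′)
      iterate {s = s} ([] , _ , _ , eq , _) t =
        contradiction (subst (vars s eᵛ <_) (trans (sym eq) (+-identityʳ _)) (<ᵇ-true t)) (<-irrefl refl)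
      iterate {s = s} (w ∷ ws , refl , p ∷ ps , eq , i) _ with input i | next i p
      ... | (in₁ , v₁) | halts {final = s′} r b (e≡ , i′) = 0 ,
        runs-seq (halts r b (runs-assign (length ws , ≤-refl , ws , refl , ps′ , eq′ , stable _ i′)))
        where
        in₂ = proj₁ (input i′)
        same : ∀ {n′ off adj n″ off′ adj′} → Input n′ off adj → Input n″ off′ adj′ → off ≡ off′ × adj ≡ adj′
        same record { off≡ = refl ; adj≡ = refl } record { off≡ = refl ; adj≡ = refl } = refl , refl
        ps′ : Ascending (λ e w → arrays s′ ADJ e ≡ toℕ w) (suc (vars s′ eᵛ)) ws
        ps′ = subst₂ (λ f k → Ascending (λ e w → f e ≡ toℕ w) (suc k) ws) (proj₂ (same in₁ in₂)) (sym e≡) ps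
        eq′ : suc (vars s′ eᵛ) + length ws ≡ arrays s′ OFF (suc (vars s′ vᵛ))
        eq′ = begin
          suc (vars s′ eᵛ) + length ws    ≡⟨ +-suc (vars s′ eᵛ) (length ws) ⟨
          vars s′ eᵛ + length (w ∷ ws)    ≡⟨ cong (_+ length (w ∷ ws)) e≡ ⟩
          vars s eᵛ + length (w ∷ ws)     ≡⟨ eq ⟩
          arrays s OFF (suc (vars s vᵛ))  ≡⟨ cong₂ (λ f k → f (suc k)) (proj₁ (same in₁ in₂)) (trans v₁ (sym (proj₂ (input i′)))) ⟩
          arrays s′ OFF (suc (vars s′ vᵛ)) ∎
          where open ≡-Reasoning

      exit : ∀ {u s} → Loop u s → test (var eᵛ ≺ OFF ⟦ suc1 (var vᵛ) ⟧) s ≡ false → Q s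
      exit ([] , _ , _ , _ , i) _ = finish i
      exit {s = s} (w ∷ ws , _ , _ , eq , _) f =
        contradiction (subst (vars s eᵛ <_) eq (m<m+n (vars s eᵛ) z<s)) (<ᵇ-false f)

  occurrences : Fin n → List (Fin n) → ℕ
  occurrences w = count (w Fin.≟_)

  occurrences≡bit : ∀ {w xs} {X : Set} (d : Dec X) → Unique xs → (w ∈ xs → X) → (X → w ∈ xs) → occurrences w xs ≡ bit d
  occurrences≡bit {w} {xs} d u to from with w ∈? xs
  ... | yes w∈ = trans (≤-antisym (count≤1 (w Fin.≟_) u λ _ _ → λ p q → trans (sym p) q)
                                  (count-some (w Fin.≟_) w∈ refl)) (sym (bit-yes d (to w∈)))
  ... | no  w∉ = trans (count-none (w Fin.≟_) xs λ { x∈ refl → w∉ x∈ }) (sym (bit-no d (w∉ ∘ from)))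

  record Bumped (a : ℕ) (x : Fin n) (s s′ : Store) : Set where
    field
      vars≡   : ∀ y → (eᵛ ≡ᵇ y) ≡ false → vars s′ y ≡ vars s y
      arrays≡ : ∀ b → (a ≡ᵇ b) ≡ false → arrays s′ b ≡ arrays s b
      bumped  : ∀ w → arrays s′ a (toℕ w) ≡ bit (edge? G x w) + arrays s a (toℕ w)

  -- The current value plus the occurrences still to come is constant during the loop. As the
  -- adjacency list has no repetitions, the occurrences of a vertex in it amount to the adjacency
  -- bit.
  runs-bump : ∀ {a x s Q} → (a ≡ᵇ OFF) ≡ false → (a ≡ᵇ ADJ) ≡ false → InputAt s → vars s vᵛ ≡ toℕ x →
              (∀ {s′} → Bumped a x s s′ → Q s′) → Runs (degree L x) (bump a) s Q
  runs-bump {a} {x} {s} {Q} a≢OFF a≢ADJ in₀ v≡ q =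
    runs-each {x} I stable input next finish start
    where
    record I (ws : List (Fin n)) (s′ : Store) : Set where
      field
        vars≡   : ∀ y → (eᵛ ≡ᵇ y) ≡ false → vars s′ y ≡ vars s y
        arrays≡ : ∀ b → (a ≡ᵇ b) ≡ false → arrays s′ b ≡ arrays s b
        partial : ∀ w → arrays s′ a (toℕ w) + occurrences w ws ≡ occurrences w (neighbours x) + arrays s a (toℕ w)
    open I

    stable : ∀ {ws s′} e → I ws s′ → I ws (setVar s′ eᵛ e)
    stable {s′ = s′} e i = record
      { vars≡ = λ y ≢ → trans (cong (λ b → if b then e else vars s′ y) ≢) (vars≡ i y ≢)
      ; arrays≡ = arrays≡ i ; partial = partial i }

    input : ∀ {ws s′} → I ws s′ → InputAt s′ × vars s′ vᵛ ≡ toℕ x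
    input i = record
      { size≡ = trans (vars≡ i nᵛ refl) (Input.size≡ in₀)
      ; off≡ = trans (arrays≡ i OFF a≢OFF) (Input.off≡ in₀)
      ; adj≡ = trans (arrays≡ i ADJ a≢ADJ) (Input.adj≡ in₀) } , trans (vars≡ i vᵛ refl) v≡

    next : ∀ {w ws s′} → I (w ∷ ws) s′ → arrays s′ ADJ (vars s′ eᵛ) ≡ toℕ w →
           Runs 0 (a ⟦ ADJ ⟦ var eᵛ ⟧ ⟧≔ suc1 (a ⟦ ADJ ⟦ var eᵛ ⟧ ⟧)) s′ (λ s″ → vars s″ eᵛ ≡ vars s′ eᵛ × I ws s″)
    next {w} {ws} {s′} i at = runs-write (refl , record
      { vars≡ = vars≡ i
      ; arrays≡ = λ b ≢ → trans (cong (λ c → if c then written-cells else arrays s′ b) ≢) (arrays≡ i b ≢)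
      ; partial = λ u → trans (cong (_+ occurrences u ws) (written u)) (trans (moved u) (partial i u)) })
      where
      k = arrays s′ ADJ (vars s′ eᵛ)
      written-cells = update (arrays s′ a) k (suc (arrays s′ a k))
      new = update (arrays s′) a written-cells

      at-w : ∀ u → update (arrays s′ a) k (suc (arrays s′ a k)) (toℕ u) ≡ bit (u Fin.≟ w) + arrays s′ a (toℕ u)
      at-w u rewrite at = go (u Fin.≟ w)
        where
        go : (d : Dec (u ≡ w)) → update (arrays s′ a) (toℕ w) (suc (arrays s′ a (toℕ w))) (toℕ u) ≡ bit d + arrays s′ a (toℕ u)
        go (yes refl) = update-same {f = arrays s′ a} {toℕ w}
        go (no u≢w)   = update-toℕ {f = arrays s′ a} (u≢w ∘ sym)

      written : ∀ u → new a (toℕ u) ≡ bit (u Fin.≟ w) + arrays s′ a (toℕ u)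
      written u = trans (cong (λ f → f (toℕ u)) (update-same {f = arrays s′} {a})) (at-w u)

      moved : ∀ u → bit (u Fin.≟ w) + arrays s′ a (toℕ u) + occurrences u ws ≡ arrays s′ a (toℕ u) + occurrences u (w ∷ ws)
      moved u = trans (cong (_+ occurrences u ws) (+-comm (bit (u Fin.≟ w)) _)) (+-assoc (arrays s′ a (toℕ u)) _ _)

    finish : ∀ {s′} → I [] s′ → Q s′
    finish i = q (record { vars≡ = vars≡ i ; arrays≡ = arrays≡ i ; bumped = λ w →
      trans (sym (+-identityʳ _)) (trans (partial i w)
        (cong (_+ arrays s a (toℕ w)) (occurrences≡bit (edge? G x w) (unique x)
          (Equivalence.to (complete x w)) (Equivalence.from (complete x w))))) })

    start : I (neighbours x) s
    start = record { vars≡ = λ _ _ → refl ; arrays≡ = λ _ _ → refl ; partial = λ w → +-comm (arrays s a (toℕ w)) _ }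

-- A queue with lazy deletion: bucket k is a linked list of cells, where cell
-- c + 1 holds a vertex in VAL and the next cell in NEXT, and 0 is the empty
-- list.  A vertex enters a new bucket whenever its count grows; the entries
-- left behind are recognised as stale once it has been visited.
push : Cmd
push = fᵛ ≔ suc1 (var fᵛ) ⨾
       VAL ⟦ var fᵛ ⟧≔ var wᵛ ⨾
       NEXT ⟦ var fᵛ ⟧≔ HEAD ⟦ CNT ⟦ var wᵛ ⟧ ⟧ ⨾
       HEAD ⟦ CNT ⟦ var wᵛ ⟧ ⟧≔ var fᵛ

fill : Cmd
fill = WHILE var wᵛ ≺ var nᵛ DO (push ⨾ wᵛ ≔ suc1 (var wᵛ))

visit : Cmd
visit = ORD ⟦ var iᵛ ⟧≔ var vᵛ ⨾
        iᵛ ≔ suc1 (var iᵛ) ⨾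
        POS ⟦ var vᵛ ⟧≔ var iᵛ ⨾
        bump CNT ⨾
        each (wᵛ ≔ ADJ ⟦ var eᵛ ⟧ ⨾ push) ⨾
        jᵛ ≔ suc1 (var jᵛ)

pop : Cmd
pop = vᵛ ≔ VAL ⟦ HEAD ⟦ var jᵛ ⟧ ⟧ ⨾
      HEAD ⟦ var jᵛ ⟧≔ NEXT ⟦ HEAD ⟦ var jᵛ ⟧ ⟧ ⨾
      IF POS ⟦ var vᵛ ⟧ ≐ lit 0 THEN visit ELSE skip

search : Cmd
search = fill ⨾
         WHILE var iᵛ ≺ var nᵛ DO
           IF HEAD ⟦ var jᵛ ⟧ ≐ lit 0 THEN jᵛ ≔ pred1 (var jᵛ) ELSE pop

-- The bucket queue

data Chain {n} (next val : ℕ → ℕ) (free : ℕ) : ℕ → List (Fin n) → Set where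
  []  : Chain next val free 0 []
  _∷_ : ∀ {c w ws} → c < free × val (suc c) ≡ toℕ w → Chain next val free (next (suc c)) ws →
        Chain next val free (suc c) (w ∷ ws)

chain-fresh : ∀ {n next val free p q h} {ws : List (Fin n)} → Chain next val free h ws →
              Chain (update next (suc free) p) (update val (suc free) q) (suc free) h ws
chain-fresh [] = []
chain-fresh {next = next} {val} {free} {p} {q} (_∷_ {c} (c< , eq) ch) =
  (m≤n⇒m≤1+n c< , trans (update-other {f = val} f≢c) eq) ∷
  subst (λ h → Chain _ _ _ h _) (sym (update-other {f = next} f≢c)) (chain-fresh ch)
  where
  f≢c : suc free ≢ suc c
  f≢c refl = <-irrefl refl c<

update-both : {X Y : Set} (R : X → Y → Set) {f : ℕ → X} {g : ℕ → Y} {i : ℕ} {a : X} {b : Y} →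
              R a b → (∀ k → R (f k) (g k)) → ∀ k → R (update f i a k) (update g i b k)
update-both R {i = i} r rs k with i ≡ᵇ k
... | true  = r
... | false = rs k

suc-≤ : ∀ {m n} → suc m ≤ n → ∃[ n′ ] n ≡ suc n′ × m ≤ n′
suc-≤ (s≤s le) = _ , refl , le

module _ {n : ℕ} where

  Buckets : Set
  Buckets = ℕ → List (Fin n)

  -- The search pops only from buckets below `n`, so the entries in these buckets are the ones to be
  -- paid for.
  total : Buckets → ℕ
  total B = ∑ (upTo n) (length ∘ B)

  length-update : ∀ (B : Buckets) i ws k → (i ≡ k → length ws ≡ suc (length (B i))) →
                  length (update B i ws k) ≤ bit (i ≟ k) + length (B k)
  length-update B i ws k h = go (i ≟ k)
    where
    go : Dec (i ≡ k) → length (update B i ws k) ≤ bit (i ≟ k) + length (B k)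
    go (yes refl) = ≤-reflexive (trans (cong length (update-same {f = B} {i}))
      (trans (h refl) (cong (_+ length (B i)) (sym (bit-yes (i ≟ i) refl)))))
    go (no i≢k) = ≤-trans (≤-reflexive (cong length (update-other {f = B} i≢k))) (m≤n+m _ (bit (i ≟ k)))

  total-push : ∀ (B : Buckets) i w → total (update B i (w ∷ B i)) ≤ suc (total B)
  total-push B i w = begin
    total (update B i (w ∷ B i))                       ≤⟨ ∑-mono (upTo n) (λ {k} _ → length-update B i _ k λ _ → refl) ⟩
    ∑ (upTo n) (λ k → bit (i ≟ k) + length (B k))      ≡⟨ ∑-+ (upTo n) _ _ ⟩
    count (i ≟_) (upTo n) + total B                    ≤⟨ +-monoˡ-≤ _ (count≤1 (i ≟_) (upTo⁺ n) λ _ _ p q → trans (sym p) q) ⟩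
    suc (total B)                                      ∎
    where open ≤-Reasoning

  total-pop : ∀ (B : Buckets) {i w ws} → i < n → B i ≡ w ∷ ws → suc (total (update B i ws)) ≤ total B
  total-pop B {i} {w} {ws} i<n eq = begin
    1 + total (update B i ws)                                  ≤⟨ +-monoˡ-≤ _ (count-some (i ≟_) (∈-upTo⁺ i<n) refl) ⟩
    count (i ≟_) (upTo n) + total (update B i ws)              ≡⟨ ∑-+ (upTo n) _ _ ⟨
    ∑ (upTo n) (λ k → bit (i ≟ k) + length (update B i ws k))  ≤⟨ ∑-mono (upTo n) (λ {k} _ → shrinks k) ⟩
    total B                                                    ∎
    where
    open ≤-Reasoning
    shrinks : ∀ k → bit (i ≟ k) + length (update B i ws k) ≤ length (B k)
    shrinks k = go (i ≟ k)
      where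
      go : Dec (i ≡ k) → bit (i ≟ k) + length (update B i ws k) ≤ length (B k)
      go (yes refl) = ≤-reflexive (trans
        (cong₂ _+_ (bit-yes (i ≟ i) refl) (cong length (update-same {f = B} {i})))
        (cong length (sym eq)))
      go (no i≢k) = ≤-reflexive (cong₂ _+_ (bit-no (i ≟ k) i≢k) (cong length (update-other {f = B} i≢k)))

  -- `honest` holds for stale entries too, because counts only grow; it bounds the count of a popped
  -- vertex from below. `pending` lists the vertices still to be pushed: initially all of them,
  -- later the neighbours of the vertex just visited.
  record Queue (cnt head next val : ℕ → ℕ) (free : ℕ) (vs pending : List (Fin n)) (T : ℕ) : Set where
    field
      buckets : Buckets
      chains  : ∀ k → Chain next val free (head k) (buckets k)
      honest  : ∀ {k w} → w ∈ buckets k → k ≤ cnt (toℕ w)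
      queued  : ∀ {w} → w ∉ vs → w ∈ pending ⊎ w ∈ buckets (cnt (toℕ w))
      small   : total buckets + length pending ≤ T

  QueueAt : Store → List (Fin n) → List (Fin n) → ℕ → Set
  QueueAt s = Queue (arrays s CNT) (arrays s HEAD) (arrays s NEXT) (arrays s VAL) (vars s fᵛ)

  module _ {cnt head next val : ℕ → ℕ} {free : ℕ} {vs : List (Fin n)} where

    queue-push : ∀ {w ws T k p} → k ≡ cnt (toℕ w) → p ≡ toℕ w → Queue cnt head next val free vs (w ∷ ws) T →
                 Queue cnt (update head k (suc free)) (update next (suc free) (head k)) (update val (suc free) p)
                       (suc free) vs ws T
    queue-push {w} {ws} {T} refl refl q = record
      { buckets = B′
      ; chains = update-both (Chain next′ val′ (suc free)) {i = k}
          ((n<1+n free , update-same {f = val} {suc free}) ∷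
            subst (λ h → Chain next′ val′ (suc free) h (buckets k)) (sym (update-same {f = next} {suc free}))
                  (chain-fresh (chains k)))
          (λ i → chain-fresh (chains i))
      ; honest = λ {k′} → honest′ k′
      ; queued = queued′
      ; small = ≤-trans (+-monoˡ-≤ (length ws) (total-push buckets k w))
                        (≤-trans (≤-reflexive (sym (+-suc _ (length ws)))) small)
      }
      where
      open Queue q
      k = cnt (toℕ w)
      next′ = update next (suc free) (head k)
      val′ = update val (suc free) (toℕ w)
      B′ = update buckets k (w ∷ buckets k)

      honest′ : ∀ k′ {u} → u ∈ B′ k′ → k′ ≤ cnt (toℕ u)
      honest′ k′ u∈ with k ≡ᵇ k′ in eq
      ... | false = honest u∈
      honest′ k′ (here refl) | true = ≤-reflexive (sym (≡ᵇ-true eq))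
      honest′ k′ (there u∈)  | true = subst (_≤ _) (≡ᵇ-true eq) (honest u∈)

      grows : ∀ {k′ u} → u ∈ buckets k′ → u ∈ B′ k′
      grows {k′} u∈ with k ≡ᵇ k′ in eq
      ... | false = u∈
      ... | true  = there (subst (λ j → _ ∈ buckets j) (sym (≡ᵇ-true eq)) u∈)

      queued′ : ∀ {u} → u ∉ vs → u ∈ ws ⊎ u ∈ B′ (cnt (toℕ u))
      queued′ u∉ with queued u∉
      ... | inj₁ (here refl) = inj₂ (subst (w ∈_) (sym (update-same {f = buckets} {k})) (here refl))
      ... | inj₁ (there u∈)  = inj₁ u∈
      ... | inj₂ u∈          = inj₂ (grows u∈)

    queue-empty : ∀ {ws T k} → head k ≡ 0 → Queue cnt head next val free vs ws T →
                  ∀ {w} → w ∉ vs → w ∉ ws → cnt (toℕ w) ≢ k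
    queue-empty {k = k} h≡0 q w∉ w∉ws refl with Queue.queued q w∉
    ... | inj₁ w∈ = w∉ws w∈
    ... | inj₂ w∈ with Queue.buckets q k | subst (λ h → Chain _ _ _ h _) h≡0 (Queue.chains q k)
    ...   | [] | [] with () ← w∈

    -- The popped vertex joins the visited list because the entry removed may have been its valid
    -- one. For a vertex visited before, this changes nothing.
    queue-pop : ∀ {T j c} → j < n → head j ≡ suc c → Queue cnt head next val free vs [] T →
                ∃[ w ] ∃[ T′ ] val (suc c) ≡ toℕ w × j ≤ cnt (toℕ w) × T ≡ suc T′ ×
                  Queue cnt (update head j (next (suc c))) next val free (w ∷ vs) [] T′
    queue-pop {T} {j} {c} j<n h≡ q = go (buckets j) refl (subst (λ h → Chain _ _ _ h (buckets j)) h≡ (chains j)) small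
      where
      open Queue q
      go : ∀ us → buckets j ≡ us → Chain next val free (suc c) us → total buckets + 0 ≤ T → _
      go (w ∷ ws) eq ((_ , v≡) ∷ ch) le with suc-≤ (≤-trans (total-pop buckets j<n eq) (≤-trans (m≤m+n _ 0) le))
      ... | T′ , T≡ , le′ = w , T′ , v≡ , honest (subst (w ∈_) (sym eq) (here refl)) , T≡ , record
        { buckets = update buckets j ws
        ; chains = update-both (Chain next val free) {i = j} ch chains
        ; honest = λ {k} → honest′ k
        ; queued = queued′
        ; small = ≤-trans (≤-reflexive (+-identityʳ _)) le′
        }
        where
        honest′ : ∀ k {u} → u ∈ update buckets j ws k → k ≤ cnt (toℕ u)
        honest′ k u∈ with j ≡ᵇ k in e
        ... | false = honest u∈
        ... | true  = honest (subst (λ i → _ ∈ buckets i) (≡ᵇ-true e) (subst (_ ∈_) (sym eq) (there u∈)))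

        queued′ : ∀ {u} → u ∉ w ∷ vs → u ∈ [] ⊎ u ∈ update buckets j ws (cnt (toℕ u))
        queued′ {u} u∉ with queued (u∉ ∘ there)
        ... | inj₂ u∈ with j ≡ᵇ cnt (toℕ u) in e
        ...   | false = inj₂ u∈
        ...   | true with subst (u ∈_) (trans (cong buckets (sym (≡ᵇ-true e))) eq) u∈
        ...     | here refl = contradiction (here refl) u∉
        ...     | there u∈ws = inj₂ u∈ws

-- Correctness and running time of the search

unusedBySearch : ℕ → Bool
unusedBySearch b = (OUT ≡ᵇ b) ∨ (VAL <ᵇ b)

-- The later phases rely on these arrays being zero after the search, where they represent empty
-- sets and counters.
Fresh : (ℕ → ℕ → ℕ) → Set
Fresh f = ∀ b → unusedBySearch b ≡ true → ∀ i → f b i ≡ 0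

used≢unused : ∀ {a b} → unusedBySearch a ≡ false → unusedBySearch b ≡ true → (a ≡ᵇ b) ≡ false
used≢unused {a} {b} ua ub = ≢⇒≡ᵇ-false {a} {b} λ { refl → contradiction (trans (sym ua) ub) λ () }

fresh-write : ∀ {f a g} → unusedBySearch a ≡ false → Fresh f → Fresh (update f a g)
fresh-write {f} {a} {g} ua fr b ub i =
  trans (cong (λ c → (if c then g else f b) i) (used≢unused {a} {b} ua ub)) (fr b ub i)

module _ {A : Set} {P Q : ℕ → A → Set} where

  down-map : ∀ {xs} → (∀ {k x} → x ∈ xs → k < length xs → P k x → Q k x) → Down P xs → Down Q xs
  down-map h []       = []
  down-map {x ∷ xs} h (p ∷ ps) = h (here refl) (n<1+n (length xs)) p ∷ down-map (λ x∈ k< → h (there x∈) (m≤n⇒m≤1+n k<)) ps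

unique-≤ : ∀ {n} {vs : List (Fin n)} → Unique vs → length vs ≤ n
unique-≤ {n} {vs} u = subst (length vs ≤_) (length-tabulate {n = n} id) (length-⊆ u (λ _ → ∈-allFin _))

complete-list : ∀ {n} {vs : List (Fin n)} → Unique vs → n ≤ length vs → ∀ v → v ∈ vs
complete-list {vs = vs} u n≤ v = decidable-stable (v ∈? vs) λ v∉ →
  <-irrefl refl (<-≤-trans (unique-≤ (∉⇒Unique v∉ u)) n≤)

incomplete-list : ∀ {n} {vs : List (Fin n)} → length vs < n → ∃[ v ] v ∉ vs
incomplete-list {n} {vs} l< with Fin.any? (λ v → ¬? (v ∈? vs))
... | yes found = found
... | no  none  = contradiction
  (subst (_≤ length vs) (length-tabulate {n = n} id)
    (length-⊆ (allFin⁺ n) (λ {v} _ → decidable-stable (v ∈? vs) λ v∉ → none (v , v∉))))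
  (<⇒≱ l<)

ascending-tabulate : ∀ {m n} (g : Fin m → Fin n) k → (∀ i → toℕ (g i) ≡ k + toℕ i) →
                     Ascending (λ j w → j ≡ toℕ w) k (tabulate g)
ascending-tabulate {zero}  g k h = []
ascending-tabulate {suc m} g k h =
  sym (trans (h zero) (+-identityʳ k)) ∷ ascending-tabulate (g ∘ suc) (suc k) (λ i → trans (h (suc i)) (+-suc k (toℕ i)))

module _ {n} (G : Graph n) where

  -- Positions start at one because a zero in `POS` stands for an unvisited vertex.
  record Visited (i : ℕ) (ord pos : ℕ → ℕ) (vs : List (Fin n)) : Set where
    field
      number≡   : i ≡ length vs
      distinct  : Unique vs
      placed    : Down (λ k x → ord k ≡ toℕ x × pos (toℕ x) ≡ suc k) vs
      unvisited : ∀ {w} → w ∉ vs → pos (toℕ w) ≡ 0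
      maximum   : MaxCardinality G vs

  Counted : (ℕ → ℕ) → List (Fin n) → Set
  Counted cnt vs = ∀ w → cnt (toℕ w) ≡ neighbourCount G w vs

  visited-nil : ∀ {ord pos} → (∀ i → pos i ≡ 0) → Visited 0 ord pos []
  visited-nil h = record { number≡ = refl ; distinct = [] ; placed = [] ; unvisited = λ _ → h _ ; maximum = [] }

  visited-∷ : ∀ {i ord pos vs w x} → x ≡ toℕ w → w ∉ vs →
              (∀ {u} → u ∉ w ∷ vs → neighbourCount G u vs ≤ neighbourCount G w vs) →
              Visited i ord pos vs → Visited (suc i) (update ord i x) (update pos x (suc i)) (w ∷ vs)
  visited-∷ {ord = ord} {pos} {vs} {w} refl w∉ max vis@record { number≡ = refl } = record
    { number≡ = refl
    ; distinct = ∉⇒Unique w∉ distinct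
    ; placed = (update-same {f = ord} {length vs} , update-same {f = pos} {toℕ w}) ∷ down-map
        (λ x∈ k< (o , p) →
          trans (update-other {f = ord} (λ eq → <-irrefl (sym eq) k<)) o ,
          trans (update-toℕ {f = pos} {v = w} λ { refl → w∉ x∈ }) p)
        placed
    ; unvisited = λ u∉ → trans (update-toℕ {f = pos} {v = w} (λ { refl → u∉ (here refl) })) (unvisited (u∉ ∘ there))
    ; maximum = max ∷ maximum
    }
    where open Visited vis

  visited⇒pos≢0 : ∀ {i ord pos vs w} → Visited i ord pos vs → w ∈ vs → pos (toℕ w) ≢ 0
  visited⇒pos≢0 vis w∈ eq = go (Visited.placed vis) w∈
    where
    go : ∀ {xs} → Down _ xs → _ ∈ xs → ⊥
    go ((_ , p) ∷ _) (here refl) with () ← trans (sym p) eq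
    go (_ ∷ ps) (there x∈) = go ps x∈

module _ {n} {G : Graph n} (L : AdjacencyLists G) where
  open AdjacencyLists L

  cost : Fin n → ℕ
  cost v = suc (degree L v)

  totalCost : ℕ
  totalCost = ∑ (allFin n) cost

  VisitedAt : Store → List (Fin n) → Set
  VisitedAt s = Visited G (vars s iᵛ) (arrays s ORD) (arrays s POS)

  record Filling (u w i j : ℕ) (arrs : ℕ → ℕ → ℕ) (f : ℕ) : Set where
    field
      pending : List (Fin n)
      length≡ : length pending ≡ u
      listed  : Ascending (λ k v → k ≡ toℕ v) w pending
      end     : w + length pending ≡ n
      input   : Input L n (arrs OFF) (arrs ADJ)
      i≡0     : i ≡ 0
      j≡0     : j ≡ 0
      unplaced : ∀ k → arrs POS k ≡ 0
      fresh   : Fresh arrs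
      counts  : ∀ k → arrs CNT k ≡ 0
      queue   : Queue (arrs CNT) (arrs HEAD) (arrs NEXT) (arrs VAL) f [] pending n

  -- d is the cost of the vertices still to be visited, and load bounds the
  -- number of entries of the queue.
  record Searching (u : ℕ) (s : Store) : Set where
    field
      visited : List (Fin n)
      d load  : ℕ
      input   : InputAt L s
      fresh   : Fresh (arrays s)
      vis     : VisitedAt s visited
      counted : Counted G (arrays s CNT) visited
      queue   : QueueAt s visited [] load
      top     : ∀ {w} → w ∉ visited → arrays s CNT (toℕ w) ≤ vars s jᵛ
      j≤      : vars s jᵛ ≤ length visited
      d≡      : ∑ visited cost + d ≡ totalCost
      u≥      : d + d + (load + vars s jᵛ) ≤ u

  record Searched (s : Store) : Set where
    field
      visited  : List (Fin n)
      input    : InputAt L s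
      fresh    : Fresh (arrays s)
      vis      : VisitedAt s visited
      complete : ∀ v → v ∈ visited

  InnerAt : (w : Fin n) (vs : List (Fin n)) (j T : ℕ) → List (Fin n) → Store → Set
  InnerAt w vs j T ws s =
    InputAt L s × vars s vᵛ ≡ toℕ w × vars s jᵛ ≡ j × Fresh (arrays s) × VisitedAt s vs ×
    Counted G (arrays s CNT) vs × QueueAt s vs ws T

  runs-visit : ∀ {s w vs j T Q} → InputAt L s → vars s vᵛ ≡ toℕ w → vars s jᵛ ≡ j → Fresh (arrays s) →
               VisitedAt s vs → Counted G (arrays s CNT) vs → w ∉ vs →
               (∀ {u} → u ∉ w ∷ vs → neighbourCount G u vs ≤ neighbourCount G w vs) →
               QueueAt s (w ∷ vs) [] T →
               (∀ {s′} → InputAt L s′ → vars s′ jᵛ ≡ suc j → Fresh (arrays s′) → VisitedAt s′ (w ∷ vs) →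
                 Counted G (arrays s′ CNT) (w ∷ vs) → QueueAt s′ (w ∷ vs) [] (degree L w + T) → Q s′) →
               Runs (degree L w) visit s Q
  runs-visit {s} {w} {vs} {j} {T} {Q} input v≡ j≡ fresh vis counted w∉ max queue q =
    runs-seq (runs-write (runs-seq (runs-assign (runs-seq (runs-write (runs-seq
      (runs-bump L refl refl input v≡ λ b → runs-seq
        (runs-each L (InnerAt w (w ∷ vs) j (degree L w + T)) (λ e i → i) (λ (inp , v , _) → inp , v)
          (λ {_} {_} {s₂} (inp , v , j , fr , vi , co , qu) at → runs-seq (runs-assign
            (runs-seq (runs-assign (runs-seq (runs-write (runs-seq (runs-write (runs-write
              (refl , inp , v , j
              , fresh-write {a = HEAD} refl (fresh-write {a = NEXT} refl (fresh-write {a = VAL} refl fr))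
              , vi , co , queue-push (cong (arrays s₂ CNT) at) at qu))))))))))
          (λ (inp , _ , j≡ , fr , vi , co , qu) → runs-assign (q inp (cong suc j≡) fr vi co qu))
          (bumped b)))))))))
    where
    s₁ : Store
    s₁ = setCell (setVar (setCell s ORD (vars s iᵛ) (vars s vᵛ)) iᵛ (suc (vars s iᵛ)))
                 POS (vars s vᵛ) (suc (vars s iᵛ))

    fresh₁ : Fresh (arrays s₁)
    fresh₁ = fresh-write {a = POS} refl (fresh-write {a = ORD} refl fresh)

    bumped : ∀ {s₂} → Bumped L CNT w s₁ s₂ → InnerAt w (w ∷ vs) j (degree L w + T) (neighbours w) s₂
    bumped {s₂} b rewrite Bumped.vars≡ b iᵛ refl | Bumped.vars≡ b nᵛ refl | Bumped.vars≡ b fᵛ refl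
                        | Bumped.arrays≡ b OFF refl | Bumped.arrays≡ b ADJ refl
                        | Bumped.arrays≡ b ORD refl | Bumped.arrays≡ b POS refl
                        | Bumped.arrays≡ b HEAD refl | Bumped.arrays≡ b NEXT refl | Bumped.arrays≡ b VAL refl =
      input , trans (Bumped.vars≡ b vᵛ refl) v≡ , trans (Bumped.vars≡ b jᵛ refl) j≡
      , (λ a ua i → trans (cong (λ f → f i) (Bumped.arrays≡ b a (used≢unused {CNT} {a} refl ua))) (fresh₁ a ua i))
      , visited-∷ G v≡ w∉ max vis
      , (λ u → trans (Bumped.bumped b u) (cong (bit (edge? G w u) +_) (counted u)))
      , record
        { buckets = buckets
        ; chains = chains
        ; honest = λ {k} {u} u∈ → ≤-trans (honest u∈) (≤-trans (m≤n+m _ (bit (edge? G w u))) (≤-reflexive (sym (Bumped.bumped b u))))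
        ; queued = λ {u} u∉ → queued′ u∉ (edge? G w u)
        ; small = ≤-trans (≤-reflexive (+-comm _ (degree L w)))
                          (+-monoʳ-≤ (degree L w) (≤-trans (≤-reflexive (sym (+-identityʳ _))) small))
        }
      where
      open Queue queue
      queued′ : ∀ {u} → u ∉ w ∷ vs → Dec (Edge G w u) → u ∈ neighbours w ⊎ u ∈ buckets (arrays s₂ CNT (toℕ u))
      queued′ {u} u∉ (yes wu) = inj₁ (Equivalence.from (complete w u) wu)
      queued′ {u} u∉ (no ¬wu) with queued u∉
      ... | inj₂ u∈ = inj₂ (subst (λ k → u ∈ buckets k)
        (sym (trans (Bumped.bumped b u) (cong (_+ arrays s CNT (toℕ u)) (bit-no (edge? G w u) ¬wu)))) u∈)

  perform-visit : ∀ {u s w vs d load T} → InputAt L s → Fresh (arrays s) → VisitedAt s vs →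
                  Counted G (arrays s CNT) vs → w ∉ vs → arrays s CNT (toℕ w) ≥ vars s jᵛ →
                  (∀ {w} → w ∉ vs → arrays s CNT (toℕ w) ≤ vars s jᵛ) → vars s jᵛ ≤ length vs →
                  ∑ vs cost + d ≡ totalCost → load ≡ suc T → d + d + (load + vars s jᵛ) ≤ u →
                  vars s vᵛ ≡ toℕ w → QueueAt s (w ∷ vs) [] T →
                  Runs (degree L w) visit s (λ s′ → ∃[ u′ ] suc (degree L w) + u′ ≤ u × Searching u′ s′)
  perform-visit {u} {s} {w} {vs} {d} {_} {T} input fresh vis counted w∉ j≤cnt top j≤ d≡ refl u≥ v≡ queue =
    runs-visit input v≡ refl fresh vis counted w∉
      -- Every unvisited vertex has count at most `j`, and the popped vertex has count at least `j`;
      -- so its count is maximum.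
      (λ {x} x∉ → subst₂ _≤_ (counted x) (counted w) (≤-trans (top (x∉ ∘ there)) j≤cnt))
      queue
      λ {s′} input′ j≡ fresh′ vis′ counted′ queue′ →
        d′ + d′ + (degree L w + T + suc j) , released , record
          { visited = w ∷ vs
          ; d = d′
          ; load = degree L w + T
          ; input = input′
          ; fresh = fresh′
          ; vis = vis′
          ; counted = counted′
          ; queue = queue′
          ; top = λ {x} x∉ → subst₂ _≤_ (sym (counted′ x)) (sym j≡)
              (+-mono-≤ (bit≤1 (edge? G w x)) (subst (_≤ j) (counted x) (top (x∉ ∘ there))))
          ; j≤ = subst (_≤ suc (length vs)) (sym j≡) (s≤s j≤)
          ; d≡ = trans (cong (_+ d′) (+-comm (cost w) (∑ vs cost))) (trans (+-assoc (∑ vs cost) (cost w) d′)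
                   (trans (cong (∑ vs cost +_) (sym d≡′)) d≡))
          ; u≥ = ≤-reflexive (cong (λ i → d′ + d′ + (degree L w + T + i)) j≡)
          }
    where
    j = vars s jᵛ

    fits : cost w ≤ d
    fits = +-cancelˡ-≤ (∑ vs cost) _ _ (begin
      ∑ vs cost + cost w    ≡⟨ +-comm (∑ vs cost) (cost w) ⟩
      ∑ (w ∷ vs) cost       ≤⟨ ∑-⊆ cost (∉⇒Unique w∉ (Visited.distinct vis)) (λ _ → ∈-allFin _) ⟩
      totalCost             ≡⟨ d≡ ⟨
      ∑ vs cost + d         ∎)
      where open ≤-Reasoning

    d′ = d ∸ cost w

    d≡′ : d ≡ cost w + d′
    d≡′ = sym (m+[n∸m]≡n fits)

    open +-*-Solver
    -- The reason for counting `d` twice: the visit lowers `d` by `cost w`, which releases twice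
    -- that amount. One half pays for the visit, the other for the `degree L w` new entries and the
    -- increment of `j`. The unit of the popped entry is to spare.
    balance : ∀ g e t i → suc g + (e + e + (g + t + suc i)) ≡ suc g + e + (suc g + e) + (t + i)
    balance = solve 4 (λ g e t i → con 1 :+ g :+ (e :+ e :+ (g :+ t :+ (con 1 :+ i)))
                := con 1 :+ g :+ e :+ (con 1 :+ g :+ e) :+ (t :+ i)) refl

    released : suc (degree L w) + (d′ + d′ + (degree L w + T + suc j)) ≤ u
    released = begin
      suc (degree L w) + (d′ + d′ + (degree L w + T + suc j)) ≡⟨ balance (degree L w) d′ T j ⟩
      cost w + d′ + (cost w + d′) + (T + j)   ≡⟨ cong (λ e → e + e + (T + j)) d≡′ ⟨
      d + d + (T + j)                         ≤⟨ +-monoʳ-≤ (d + d) (n≤1+n (T + j)) ⟩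
      d + d + (suc T + j)                     ≤⟨ u≥ ⟩
      u                                       ∎
      where open ≤-Reasoning

  searchBody : Cmd
  searchBody = IF HEAD ⟦ var jᵛ ⟧ ≐ lit 0 THEN jᵛ ≔ pred1 (var jᵛ) ELSE pop

  search-iterate : ∀ {u s} → Searching u s → vars s iᵛ < n →
                   ∃[ k ] Runs k searchBody s (λ s′ → ∃[ u′ ] suc k + u′ ≤ u × Searching u′ s′)
  search-iterate {u} {s} S i<n = go (arrays s HEAD j) refl
    where
    open Searching S
    j = vars s jᵛ

    l<n : length visited < n
    l<n = subst (_< n) (Visited.number≡ vis) i<n

    empty : arrays s HEAD j ≡ 0 → Runs 0 (jᵛ ≔ pred1 (var jᵛ)) s (λ s′ → ∃[ u′ ] 1 + u′ ≤ u × Searching u′ s′)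
    empty h≡0 = runs-assign (lower j refl)
      where
      below : ∀ {w} → w ∉ visited → suc (arrays s CNT (toℕ w)) ≤ j
      below w∉ = ≤∧≢⇒< (top w∉) (queue-empty h≡0 queue w∉ λ ())
      lower : ∀ j′ → j ≡ j′ → ∃[ u′ ] 1 + u′ ≤ u × Searching u′ (setVar s jᵛ (pred j))
      -- The pointer is positive whenever its bucket is empty: some vertex is still unvisited, and
      -- its count is below the pointer.
      lower zero j≡ with incomplete-list l<n
      ... | w , w∉ with () ← subst (_ ≤_) j≡ (below w∉)
      lower (suc j′) j≡ = d + d + (load + pred j) ,
        ≤-trans (≤-reflexive (trans (sym (+-suc (d + d) (load + pred j)))
                  (cong (d + d +_) (trans (sym (+-suc load (pred j))) (cong (load +_) (suc-pred′ j≡)))))) u≥ ,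
        record
          { visited = visited ; d = d ; load = load ; input = input ; fresh = fresh ; vis = vis
          ; counted = counted ; queue = queue
          ; top = λ w∉ → ≤-pred (subst (_ ≤_) (sym (suc-pred′ j≡)) (below w∉))
          ; j≤ = ≤-trans pred[n]≤n j≤
          ; d≡ = d≡ ; u≥ = ≤-refl }
        where
        suc-pred′ : ∀ {k} → k ≡ suc j′ → suc (pred k) ≡ k
        suc-pred′ refl = refl

    QueueAfter : ℕ → List (Fin n) → ℕ → Set
    QueueAfter h vs = Queue (arrays s CNT) (update (arrays s HEAD) j (arrays s NEXT h)) (arrays s NEXT) (arrays s VAL)
                            (vars s fᵛ) vs []

    popped : ∀ {c w T} → arrays s HEAD j ≡ suc c → arrays s VAL (suc c) ≡ toℕ w → j ≤ arrays s CNT (toℕ w) →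
             load ≡ suc T →
             QueueAfter (suc c) (w ∷ visited) T →
             ∃[ k ] Runs k pop s (λ s′ → ∃[ u′ ] suc k + u′ ≤ u × Searching u′ s′)
    popped {c} {w} {T} h≡ v≡ j≤cnt load≡ q with w ∈? visited
    -- A stale entry: the load drops by one, which pays for the iteration.
    ... | yes w∈ = 0 , runs-seq (runs-assign (runs-seq (runs-write (runs-if
        (λ t → contradiction (≡ᵇ-true t) λ p≡0 → visited⇒pos≢0 G vis w∈ (subst (λ x → arrays s POS x ≡ 0) v≡′ p≡0))
        (λ _ → runs-skip (d + d + (T + j) , released , record
          { visited = visited ; d = d ; load = T ; input = input ; fresh = fresh-write {a = HEAD} refl fresh
          ; vis = vis ; counted = counted
          ; queue = subst (λ h → QueueAfter h visited T) (sym h≡) q₁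
          ; top = top ; j≤ = j≤ ; d≡ = d≡ ; u≥ = ≤-refl }))))))
      where
      v≡′ : arrays s VAL (arrays s HEAD j) ≡ toℕ w
      v≡′ = trans (cong (arrays s VAL) h≡) v≡

      released : 1 + (d + d + (T + j)) ≤ u
      released = ≤-trans (≤-reflexive (sym (+-suc (d + d) (T + j)))) (subst (λ l → d + d + (l + j) ≤ u) load≡ u≥)

      q₁ : QueueAfter (suc c) visited T
      q₁ = record
        { buckets = Queue.buckets q ; chains = Queue.chains q ; honest = Queue.honest q
        ; queued = λ {u} u∉ → Queue.queued q λ { (here refl) → u∉ w∈ ; (there u∈) → u∉ u∈ }
        ; small = Queue.small q }

    ... | no w∉ = degree L w , runs-seq (runs-assign (runs-seq (runs-write (runs-if
        (λ _ → perform-visit input (fresh-write {a = HEAD} refl fresh) vis counted w∉ j≤cnt top j≤ d≡ load≡ u≥ v≡′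
               (subst (λ h → QueueAfter h (w ∷ visited) T) (sym h≡) q))
        (λ f → contradiction (subst (λ x → arrays s POS x ≡ 0) (sym v≡′) (Visited.unvisited vis w∉)) (≡ᵇ-false f))))))
      where v≡′ = trans (cong (arrays s VAL) h≡) v≡

    go : ∀ h → arrays s HEAD j ≡ h → ∃[ k ] Runs k searchBody s (λ s′ → ∃[ u′ ] suc k + u′ ≤ u × Searching u′ s′)
    go zero h≡ = 0 , runs-if (λ _ → empty h≡) (λ f → contradiction h≡ (≡ᵇ-false f))
    go (suc c) h≡ with queue-pop (<-≤-trans (s≤s j≤) l<n) h≡ queue
    ... | w , T , v≡ , j≤cnt , load≡ , q with popped h≡ v≡ j≤cnt load≡ q
    ...   | k , run = k , runs-if (λ t → contradiction (trans (sym h≡) (≡ᵇ-true t)) λ ()) (λ _ → run)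

  search-exit : ∀ {u s} → Searching u s → ¬ vars s iᵛ < n → Searched s
  search-exit {s = s} S i≮n = record
    { visited = visited ; input = input ; fresh = fresh ; vis = vis
    ; complete = complete-list (Visited.distinct vis) (subst (n ≤_) (Visited.number≡ vis) (≮⇒≥ i≮n)) }
    where open Searching S

  runs-fill : ∀ {s Q} → Filling n (vars s wᵛ) (vars s iᵛ) (vars s jᵛ) (arrays s) (vars s fᵛ) → vars s nᵛ ≡ n →
              (∀ {s′} → Searching (totalCost + totalCost + (n + 0)) s′ → Q s′) → Runs n fill s Q
  runs-fill {s} {Q} F n≡ q = runs-while I iterate exit (F , n≡)
    where
    I : ℕ → Store → Set
    I u s = Filling u (vars s wᵛ) (vars s iᵛ) (vars s jᵛ) (arrays s) (vars s fᵛ) × vars s nᵛ ≡ n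

    iterate : ∀ {u s} → I u s → (vars s wᵛ <ᵇ vars s nᵛ) ≡ true →
              ∃[ k ] Runs k (push ⨾ wᵛ ≔ suc1 (var wᵛ)) s (λ s′ → ∃[ u′ ] suc k + u′ ≤ u × I u′ s′)
    iterate {s = s} (record { pending = [] ; end = end } , refl) t =
      contradiction (subst (vars s wᵛ <_) (trans (sym end) (+-identityʳ _)) (<ᵇ-true t)) (<-irrefl refl)
    iterate {s = s} (F@record { pending = v ∷ vs ; length≡ = refl ; listed = w≡ ∷ listed } , n≡) t =
      0 , runs-seq (runs-seq (runs-assign (runs-seq (runs-write (runs-seq (runs-write (runs-write (runs-assign
        (length vs , ≤-refl , record
          { pending = vs ; length≡ = refl ; listed = listed
          ; end = trans (sym (+-suc (vars s wᵛ) (length vs))) end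
          ; input = input ; i≡0 = i≡0 ; j≡0 = j≡0 ; unplaced = unplaced
          ; fresh = fresh-write {a = HEAD} refl (fresh-write {a = NEXT} refl (fresh-write {a = VAL} refl fresh))
          ; counts = counts
          ; queue = queue-push (cong (arrays s CNT) w≡) w≡ queue } , n≡)))))))))
      where open Filling F using (end; input; i≡0; j≡0; unplaced; fresh; counts; queue)

    exit : ∀ {u s} → I u s → (vars s wᵛ <ᵇ vars s nᵛ) ≡ false → Q s
    exit {s = s} (record { pending = v ∷ vs ; end = end } , refl) f =
      contradiction (subst (vars s wᵛ <_) end (m<m+n (vars s wᵛ) z<s)) (<ᵇ-false f)
    exit {s = s} (F@record { pending = [] } , n≡) _ = q (record
      { visited = [] ; d = totalCost ; load = n
      ; input = record { size≡ = n≡ ; off≡ = Input.off≡ input ; adj≡ = Input.adj≡ input }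
      ; fresh = fresh
      ; vis = subst (λ i → Visited G i _ _ []) (sym i≡0) (visited-nil G unplaced)
      ; counted = λ w → counts (toℕ w)
      ; queue = queue
      ; top = λ {w} _ → subst (_≤ vars s jᵛ) (sym (counts (toℕ w))) z≤n
      ; j≤ = ≤-reflexive j≡0
      ; d≡ = refl
      ; u≥ = ≤-reflexive (cong (λ j → totalCost + totalCost + (n + j)) j≡0) })
      where open Filling F using (input; i≡0; j≡0; unplaced; fresh; counts; queue)

  filling-start : Filling n 0 0 0 (arrays (encode L)) 0
  filling-start = record
    { pending = allFin n ; length≡ = length-tabulate id
    ; listed = ascending-tabulate id 0 (λ _ → refl)
    ; end = length-tabulate id
    ; input = record { size≡ = refl ; off≡ = refl ; adj≡ = refl }
    ; i≡0 = refl ; j≡0 = refl ; unplaced = λ _ → refl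
    ; fresh = λ { 2 _ _ → refl ; (suc (suc (suc _))) _ _ → refl }
    ; counts = λ _ → refl
    ; queue = record
      { buckets = λ _ → [] ; chains = λ _ → [] ; honest = λ () ; queued = λ _ → inj₁ (∈-allFin _)
      ; small = ≤-reflexive (cong₂ _+_ (∑-0 (upTo n)) (length-tabulate id)) } }

  -- The initial potential of the search: twice the cost of all vertices, the `n` entries made by
  -- `fill`, and the pointer at bucket 0.
  searchTime : ℕ
  searchTime = totalCost + totalCost + (n + 0)

  runs-search : ∀ {Q} → (∀ {s} → Searched s → Q s) → Runs searchTime search (encode L) Q
  runs-search {Q} q = runs-seq (runs-weaken n≤ (runs-fill filling-start refl λ S →
    runs-while Searching
      (λ {_} {s} S t → search-iterate S (subst (vars s iᵛ <_) (Input.size≡ (Searching.input S)) (<ᵇ-true t)))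
      (λ {_} {s} S f → q (search-exit S λ i<n → <ᵇ-false f (subst (vars s iᵛ <_) (sym (Input.size≡ (Searching.input S))) i<n)))
      S))
    where
    n≤ : n ≤ searchTime
    n≤ = ≤-trans (m≤m+n n 0) (m≤n+m _ (totalCost + totalCost))

-- Marking and selection

markVertex : Cmd
markVertex =
  IF NM ⟦ var vᵛ ⟧ ≐ lit 0
  THEN (MARK ⟦ var vᵛ ⟧≔ lit 1 ⨾ bump NM ⨾ bump NY)
  ELSE IF NZ ⟦ var vᵛ ⟧ ≺ NY ⟦ var vᵛ ⟧
    THEN (MARK ⟦ var vᵛ ⟧≔ lit 1 ⨾ bump NM ⨾
          IF suc1 (NZ ⟦ var vᵛ ⟧) ≺ NY ⟦ var vᵛ ⟧ THEN bump NZ ELSE skip)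
    ELSE skip

-- Reading `ORD` backwards gives the elimination order, and it leaves `iᵛ` at 0, where `select`
-- starts.
mark : Cmd
mark = WHILE lit 0 ≺ var iᵛ DO (iᵛ ≔ pred1 (var iᵛ) ⨾ vᵛ ≔ ORD ⟦ var iᵛ ⟧ ⨾ markVertex)

selectVertex : Cmd
selectVertex =
  IF MARK ⟦ var vᵛ ⟧ ≐ lit 0
  THEN skip
  ELSE IF NS ⟦ var vᵛ ⟧ ≐ lit 0 THEN (OUT ⟦ var vᵛ ⟧≔ lit 1 ⨾ bump NS) ELSE skip

select : Cmd
select = WHILE var iᵛ ≺ var nᵛ DO (vᵛ ≔ ORD ⟦ var iᵛ ⟧ ⨾ selectVertex ⨾ iᵛ ≔ suc1 (var iᵛ))

program : Cmd
program = search ⨾ mark ⨾ select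

record Flags {n} (f : ℕ → ℕ) (M : List (Fin n)) : Set where
  field
    set   : ∀ {v} → v ∈ M → f (toℕ v) ≡ 1
    unset : ∀ {v} → v ∉ M → f (toℕ v) ≡ 0

flag-on : ∀ {n} {f x M} {v : Fin n} → x ≡ toℕ v → Flags f M → Flags (update f x 1) (v ∷ M)
flag-on {f = f} {v = v} refl fl = record
  { set = λ {u} u∈ → set′ (u Fin.≟ v) u∈
  ; unset = λ u∉ → trans (update-toℕ {f = f} {v = v} λ { refl → u∉ (here refl) }) (unset (u∉ ∘ there)) }
  where
  open Flags fl
  set′ : ∀ {u} → Dec (u ≡ v) → u ∈ v ∷ _ → update f (toℕ v) 1 (toℕ u) ≡ 1
  set′ (yes refl) _           = update-same {f = f} {toℕ v}
  set′ (no u≢v)   (here refl) = contradiction refl u≢v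
  set′ (no u≢v)   (there u∈)  = trans (update-toℕ {f = f} (u≢v ∘ sym)) (set u∈)

flag≡0 : ∀ {n f} {M : List (Fin n)} {v} → Flags f M → f (toℕ v) ≡ 0 → v ∉ M
flag≡0 fl eq v∈ with () ← trans (sym eq) (Flags.set fl v∈)

flag≢0 : ∀ {n f} {M : List (Fin n)} {v} → Flags f M → f (toℕ v) ≢ 0 → v ∈ M
flag≢0 {M = M} {v} fl neq = decidable-stable (v ∈? M) (neq ∘ Flags.unset fl)

∑-reverse : ∀ {A : Set} (xs : List A) f → ∑ (reverse xs) f ≡ ∑ xs f
∑-reverse []       f = refl
∑-reverse (x ∷ xs) f = begin
  ∑ (reverse (x ∷ xs)) f         ≡⟨ cong (λ ys → ∑ ys f) (unfold-reverse x xs) ⟩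
  ∑ (reverse xs ++ [ x ]) f      ≡⟨ ∑-++ (reverse xs) [ x ] f ⟩
  ∑ (reverse xs) f + (f x + 0)   ≡⟨ cong₂ _+_ (∑-reverse xs f) (+-identityʳ (f x)) ⟩
  ∑ xs f + f x                   ≡⟨ +-comm (∑ xs f) (f x) ⟩
  f x + ∑ xs f                   ∎
  where open ≡-Reasoning

down-reverse : ∀ {A : Set} {P : ℕ → A → Set} {xs} → Down P xs → Ascending P 0 (reverse xs)
down-reverse [] = []
down-reverse {P = P} {x ∷ xs} (p ∷ ps) = subst (Ascending P 0) (sym (unfold-reverse x xs))
  (ascending-++ (reverse xs) (down-reverse ps) (subst (λ k → P k x) (sym (length-reverse xs)) p ∷ []))

module _ {n} {G : Graph n} (L : AdjacencyLists G) (ord : ℕ → ℕ) where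

  -- Each of the arrays after MARK counts, for every vertex, its neighbours
  -- in some list.
  record Tables (n′ : ℕ) (arrs : ℕ → ℕ → ℕ) (lists : ℕ → List (Fin n)) (M S : List (Fin n)) : Set where
    field
      input  : Input L n′ (arrs OFF) (arrs ADJ)
      ord≡   : arrs ORD ≡ ord
      marks  : Flags (arrs MARK) M
      outs   : Flags (arrs OUT) S
      counts : ∀ a → (MARK <ᵇ a) ≡ true → ∀ w → arrs a (toℕ w) ≡ neighbourCount G w (lists a)

  TablesAt : Store → (ℕ → List (Fin n)) → List (Fin n) → List (Fin n) → Set
  TablesAt s = Tables (vars s nᵛ) (arrays s)

  counter≢ : ∀ {a b} → (MARK <ᵇ a) ≡ true → (MARK <ᵇ b) ≡ false → (a ≡ᵇ b) ≡ false
  counter≢ {a} {b} p q = ≢⇒≡ᵇ-false {a} {b} λ { refl → contradiction (trans (sym p) q) λ () }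

  -- The lists are indexed by array names so that one lemma serves all four counters.
  runs-count : ∀ {a s x k lists M S Q} → (MARK <ᵇ a) ≡ true → TablesAt s lists M S →
               vars s vᵛ ≡ toℕ x → vars s iᵛ ≡ k →
               (∀ {s′} → TablesAt s′ (update lists a (x ∷ lists a)) M S → vars s′ vᵛ ≡ toℕ x → vars s′ iᵛ ≡ k → Q s′) →
               Runs (degree L x) (bump a) s Q
  runs-count {a} {s} {x} {k} {lists} {M} {S} {Q} a> t v≡ i≡ q =
    runs-bump L (counter≢ {a} {OFF} a> refl) (counter≢ {a} {ADJ} a> refl) input v≡ λ b →
      q (bumped b) (trans (Bumped.vars≡ b vᵛ refl) v≡) (trans (Bumped.vars≡ b iᵛ refl) i≡)
    where
    open Tables t
    bumped : ∀ {s′} → Bumped L a x s s′ → TablesAt s′ (update lists a (x ∷ lists a)) M S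
    bumped {s′} b = record
      { input = record { size≡ = trans (Bumped.vars≡ b nᵛ refl) (Input.size≡ input)
                       ; off≡ = trans (Bumped.arrays≡ b OFF (counter≢ {a} {OFF} a> refl)) (Input.off≡ input)
                       ; adj≡ = trans (Bumped.arrays≡ b ADJ (counter≢ {a} {ADJ} a> refl)) (Input.adj≡ input) }
      ; ord≡ = trans (Bumped.arrays≡ b ORD (counter≢ {a} {ORD} a> refl)) ord≡
      ; marks = subst (λ f → Flags f M) (sym (Bumped.arrays≡ b MARK (counter≢ {a} {MARK} a> refl))) marks
      ; outs = subst (λ f → Flags f S) (sym (Bumped.arrays≡ b OUT (counter≢ {a} {OUT} a> refl))) outs
      ; counts = counts′
      }
      where
      counts′ : ∀ c → (MARK <ᵇ c) ≡ true → ∀ w →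
                arrays s′ c (toℕ w) ≡ neighbourCount G w (update lists a (x ∷ lists a) c)
      counts′ c c> w with a ≡ᵇ c in eq
      ... | false = trans (cong (λ f → f (toℕ w)) (Bumped.arrays≡ b c eq)) (counts c c> w)
      ... | true with ≡ᵇ-true {a} {c} eq
      ...   | refl = trans (Bumped.bumped b w) (cong (bit (edge? G x w) +_) (counts a a> w))

  tables-mark : ∀ {n′ arrs lists M S x v} → x ≡ toℕ v → Tables n′ arrs lists M S →
                Tables n′ (update arrs MARK (update (arrs MARK) x 1)) lists (v ∷ M) S
  tables-mark {arrs = arrs} x≡ t = record
    { input = input ; ord≡ = ord≡ ; marks = flag-on x≡ marks ; outs = outs
    ; counts = λ a a> w → trans (cong (λ f → f (toℕ w))
        (update-other {f = arrs} {i = MARK} {j = a} λ { refl → contradiction a> λ () })) (counts a a> w) }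
    where open Tables t

  tables-select : ∀ {n′ arrs lists M S x v} → x ≡ toℕ v → Tables n′ arrs lists M S →
                  Tables n′ (update arrs OUT (update (arrs OUT) x 1)) lists M (v ∷ S)
  tables-select {arrs = arrs} x≡ t = record
    { input = input ; ord≡ = ord≡ ; marks = marks ; outs = flag-on x≡ outs
    ; counts = λ a a> w → trans (cong (λ f → f (toℕ w))
        (update-other {f = arrs} {i = OUT} {j = a} λ { refl → contradiction a> λ () })) (counts a a> w) }
    where open Tables t

  count-at : ∀ s {lists M S x} a → (MARK <ᵇ a) ≡ true → TablesAt s lists M S → vars s vᵛ ≡ toℕ x →
             arrays s a (vars s vᵛ) ≡ neighbourCount G x (lists a)
  count-at s {x = x} a a> t v≡ rewrite v≡ = Tables.counts t a a> x

  module _ (clawFree : ClawFree G) {pos : Fin n → ℕ} (pe : PerfectElimination G pos) where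

    Located : ℕ → Fin n → Set
    Located k x = ord k ≡ toℕ x × pos x ≡ suc k

    MarkedAt : Store → ℕ → Set
    MarkedAt s k = ∃[ lists ] TablesAt s lists (lists NM) [] × vars s iᵛ ≡ k ×
                   lists NS ≡ [] × Marking G pe k (lists NY) (lists NZ) (lists NM)

    runs-markVertex : ∀ {s k x lists} → TablesAt s lists (lists NM) [] → vars s iᵛ ≡ k → vars s vᵛ ≡ toℕ x →
                      lists NS ≡ [] → Marking G pe (suc k) (lists NY) (lists NZ) (lists NM) → pos x ≡ suc k →
                      Runs (degree L x) markVertex s (λ s′ → MarkedAt s′ k)
    runs-markVertex {s} {k} {x} {lists} t i≡ v≡ ns≡ m x≡ = runs-if
      (λ z → runs-seq (runs-write (runs-seq (runs-count refl (tables-mark v≡ t) v≡ i≡ λ t₁ v₁ i₁ →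
        runs-count refl t₁ v₁ i₁ λ t₂ _ i₂ →
          _ , t₂ , i₂ , ns≡ , mark-Y G pe m x≡ (count≡0⇒none (λ u → edge? G u x) (trans (sym nm) (≡ᵇ-true z)))))))
      (λ nz → runs-if
        (λ lt → runs-seq (runs-write (runs-seq (runs-count refl (tables-mark v≡ t) v≡ i≡ λ {s₁} t₁ v₁ i₁ → runs-if
          (λ lt₁ → runs-count refl t₁ v₁ i₁ λ t₂ _ i₂ → _ , t₂ , i₂ , ns≡ , mark-Z G pe m x≡
            -- The count in `Y` is at most 2, hence at most 2 plus the count in `Z`; the test just
            -- passed gives the reverse inequality.
            (≤-antisym (≤-trans (Y-neighbours≤2 G pe clawFree m x) (s≤s (s≤s z≤n))) (below s₁ t₁ v₁ (<ᵇ-true lt₁))))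
          (λ ge₁ → runs-skip (_ , t₁ , i₁ , ns≡ , mark-E G pe m x≡
            (≤-antisym (≮⇒≥ (λ lt₁ → <ᵇ-false ge₁ (above s₁ t₁ v₁ lt₁)))
                       (subst₂ _<_ nz≡ ny≡ (<ᵇ-true lt)))))))))
        (λ ge → runs-skip (_ , t , i≡ , ns≡ , leave-unmarked G pe m x≡
          (subst₂ _≤_ ny≡ nz≡ (≮⇒≥ (<ᵇ-false ge)))
          (count≢0⇒some (λ u → edge? G u x) (lists NM) (λ eq → ≡ᵇ-false nz (trans nm eq))))))
      where
      nm  = count-at s NM refl t v≡
      ny≡ = count-at s NY refl t v≡
      nz≡ = count-at s NZ refl t v≡

      -- The inner test is evaluated after `bump NM`; the counters are read in the new store, where
      -- the lists of `NY` and `NZ` are still the old ones.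
      below : ∀ s₁ {M} → TablesAt s₁ (update lists NM (x ∷ lists NM)) M [] → vars s₁ vᵛ ≡ toℕ x →
              suc (arrays s₁ NZ (vars s₁ vᵛ)) < arrays s₁ NY (vars s₁ vᵛ) →
              suc (neighbourCount G x (lists NZ)) < neighbourCount G x (lists NY)
      below s₁ t₁ v₁ = subst₂ (λ a b → suc a < b) (count-at s₁ NZ refl t₁ v₁) (count-at s₁ NY refl t₁ v₁)

      above : ∀ s₁ {M} → TablesAt s₁ (update lists NM (x ∷ lists NM)) M [] → vars s₁ vᵛ ≡ toℕ x →
              suc (neighbourCount G x (lists NZ)) < neighbourCount G x (lists NY) →
              suc (arrays s₁ NZ (vars s₁ vᵛ)) < arrays s₁ NY (vars s₁ vᵛ)
      above s₁ t₁ v₁ = subst₂ (λ a b → suc a < b) (sym (count-at s₁ NZ refl t₁ v₁)) (sym (count-at s₁ NY refl t₁ v₁))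

    runs-mark : ∀ {s vs Q} → Down Located vs → MarkedAt s (length vs) → (∀ {s′} → MarkedAt s′ 0 → Q s′) →
                Runs (∑ vs (cost L)) mark s Q
    runs-mark {s} {vs} {Q} located m q = runs-while I iterate exit (vs , ≤-refl , located , m)
      where
      I : ℕ → Store → Set
      I u s = ∃[ xs ] ∑ xs (cost L) ≤ u × Down Located xs × MarkedAt s (length xs)

      iterate : ∀ {u s} → I u s → (0 <ᵇ vars s iᵛ) ≡ true →
                ∃[ k ] Runs k (iᵛ ≔ pred1 (var iᵛ) ⨾ vᵛ ≔ ORD ⟦ var iᵛ ⟧ ⨾ markVertex) s
                            (λ s′ → ∃[ u′ ] suc k + u′ ≤ u × I u′ s′)
      iterate ([] , _ , _ , _ , _ , i≡ , _) t = contradiction (<ᵇ-true t) (λ 0<i → <-irrefl (sym i≡) 0<i)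
      iterate {s = s} (x ∷ xs , le , (ord≡x , pos≡) ∷ ps , lists , t , i≡ , ns≡ , m) _ =
        degree L x , runs-seq (runs-assign (runs-seq (runs-assign (runs-map
          (runs-markVertex t (cong pred i≡) v≡ ns≡ m pos≡)
          (λ m′ → ∑ xs (cost L) , le , xs , ≤-refl , ps , m′)))))
        where
        v≡ : arrays s ORD (pred (vars s iᵛ)) ≡ toℕ x
        v≡ = trans (cong₂ (λ f i → f (pred i)) (Tables.ord≡ t) i≡) ord≡x

      exit : ∀ {u s} → I u s → (0 <ᵇ vars s iᵛ) ≡ false → Q s
      exit ([] , _ , _ , m) _ = q m
      exit (x ∷ xs , _ , _ , _ , _ , i≡ , _) f = contradiction (subst (0 <_) (sym i≡) z<s) (<ᵇ-false f)

    -- `hit` is stronger than maximality: selection runs through increasing positions, so a marked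
    -- vertex that is rejected has an earlier neighbour in `S`.
    record Selection (M : List (Fin n)) (k : ℕ) (S : List (Fin n)) : Set where
      field
        S⊆M   : ∀ {v} → v ∈ S → v ∈ M
        early : ∀ {v} → v ∈ S → pos v ≤ k
        indep : IndependentList G S
        hit   : ∀ {v} → v ∈ M → pos v ≤ k → ∃[ w ] w ∈ S × Up G pe v w

    no-selection : (∀ v → 0 < pos v) → ∀ {M} → Selection M 0 []
    no-selection pos>0 = record
      { S⊆M = λ () ; early = λ () ; indep = λ () ; hit = λ {v} _ le → contradiction (pos>0 v) (≤⇒≯ le) }

    module _ {M k S} (sel : Selection M k S) {x} (x≡ : pos x ≡ suc k) where
      open Selection sel

      last-cases : ∀ {v} → pos v ≤ suc k → v ≡ x ⊎ pos v ≤ k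
      last-cases {v} le with m≤n⇒m<n∨m≡n le
      ... | inj₁ lt = inj₂ (≤-pred lt)
      ... | inj₂ eq = inj₁ (PerfectElimination.injective pe (trans eq (sym x≡)))

      -- This covers both reasons for skipping `x`: the hypothesis is vacuous for an unmarked
      -- vertex.
      pass : (x ∈ M → ∃[ w ] w ∈ S × Edge G w x) → Selection M (suc k) S
      pass nbr = record
        { S⊆M = S⊆M ; early = m≤n⇒m≤1+n ∘ early ; indep = indep
        ; hit = λ v∈ le → hit′ v∈ (last-cases le) }
        where
        hit′ : ∀ {v} → v ∈ M → v ≡ x ⊎ pos v ≤ k → ∃[ w ] w ∈ S × Up G pe v w
        hit′ v∈ (inj₂ le)   = hit v∈ le
        hit′ v∈ (inj₁ refl) = let w , w∈ , wx = nbr v∈ in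
          w , w∈ , inj₂ (Edge-sym G wx , subst (pos w <_) (sym x≡) (s≤s (early w∈)))

      choose : x ∈ M → (∀ {w} → w ∈ S → ¬ Edge G w x) → Selection M (suc k) (x ∷ S)
      choose x∈ free = record
        { S⊆M = λ { (here refl) → x∈ ; (there v∈) → S⊆M v∈ }
        ; early = λ { (here refl) → ≤-reflexive x≡ ; (there v∈) → m≤n⇒m≤1+n (early v∈) }
        ; indep = λ { (here refl) (here refl) → Edge-irrefl G
                    ; (here refl) (there v∈) e → free v∈ (Edge-sym G e)
                    ; (there u∈) (here refl) e → free u∈ e
                    ; (there u∈) (there v∈) → indep u∈ v∈ }
        ; hit = λ v∈ le → hit′ v∈ (last-cases le) }
        where
        hit′ : ∀ {v} → v ∈ M → v ≡ x ⊎ pos v ≤ k → ∃[ w ] w ∈ x ∷ S × Up G pe v w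
        hit′ v∈ (inj₂ le)   = let w , w∈ , up = hit v∈ le in w , there w∈ , up
        hit′ v∈ (inj₁ refl) = x , here refl , inj₁ refl

    SelectedAt : List (Fin n) → Store → ℕ → Set
    SelectedAt M s k = ∃[ lists ] TablesAt s lists M (lists NS) × vars s iᵛ ≡ k × Selection M k (lists NS)

    runs-selectVertex : ∀ {s k x lists M Q} → TablesAt s lists M (lists NS) → vars s iᵛ ≡ k → vars s vᵛ ≡ toℕ x →
                        Selection M k (lists NS) → pos x ≡ suc k →
                        (∀ {s′ lists′} → TablesAt s′ lists′ M (lists′ NS) → vars s′ iᵛ ≡ k →
                          Selection M (suc k) (lists′ NS) → Q s′) →
                        Runs (degree L x) selectVertex s Q
    runs-selectVertex {s} {k} {x} {lists} {M} t i≡ v≡ sel x≡ q = runs-if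
      (λ z → runs-skip (q t i≡ (pass sel x≡ λ x∈ → contradiction x∈ (flag≡0 marks (at-x (≡ᵇ-true z))))))
      (λ nz → runs-if
        (λ z → runs-seq (runs-write (runs-count refl (tables-select v≡ t) v≡ i≡ λ t₁ _ i₁ →
          q t₁ i₁ (choose sel x≡ (flag≢0 marks (≡ᵇ-false nz ∘ subst (λ i → arrays s MARK i ≡ 0) (sym v≡)))
            (count≡0⇒none (λ u → edge? G u x) (trans (sym ns) (≡ᵇ-true z)))))))
        (λ nz′ → runs-skip (q t i≡ (pass sel x≡ λ _ →
          count≢0⇒some (λ u → edge? G u x) (lists NS) (λ eq → ≡ᵇ-false nz′ (trans ns eq))))))
      where
      open Tables t
      ns = count-at s NS refl t v≡
      at-x : arrays s MARK (vars s vᵛ) ≡ 0 → arrays s MARK (toℕ x) ≡ 0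
      at-x = subst (λ i → arrays s MARK i ≡ 0) v≡

    runs-select : ∀ {s vs M Q} → Ascending Located 0 vs → length vs ≡ n → SelectedAt M s 0 →
                  (∀ {s′} → SelectedAt M s′ n → Q s′) → Runs (∑ vs (cost L)) select s Q
    runs-select {s} {vs} {M} {Q} located length≡ sel q = runs-while I iterate exit (vs , 0 , ≤-refl , located , length≡ , sel)
      where
      I : ℕ → Store → Set
      I u s = ∃[ xs ] ∃[ k ] ∑ xs (cost L) ≤ u × Ascending Located k xs × k + length xs ≡ n × SelectedAt M s k

      iterate : ∀ {u s} → I u s → (vars s iᵛ <ᵇ vars s nᵛ) ≡ true →
                ∃[ k ] Runs k (vᵛ ≔ ORD ⟦ var iᵛ ⟧ ⨾ selectVertex ⨾ iᵛ ≔ suc1 (var iᵛ)) s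
                            (λ s′ → ∃[ u′ ] suc k + u′ ≤ u × I u′ s′)
      iterate ([] , k , _ , _ , end , _ , t , i≡ , _) lt =
        contradiction (<ᵇ-true lt) (<-irrefl (trans i≡ (trans (sym (+-identityʳ k)) (trans end (sym (Input.size≡ (Tables.input t)))))))
      iterate {s = s} (x ∷ xs , k , le , (ord≡x , pos≡) ∷ ps , end , lists , t , i≡ , sel) _ =
        degree L x , runs-seq (runs-assign (runs-seq (runs-selectVertex t i≡ v≡ sel pos≡
          λ {_} {lists₂} t₂ i₂ sel₂ → runs-assign (∑ xs (cost L) , le , xs , suc k , ≤-refl , ps
            , trans (sym (+-suc k (length xs))) end , lists₂ , t₂ , cong suc i₂ , sel₂))))
        where
        v≡ : arrays s ORD (vars s iᵛ) ≡ toℕ x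
        v≡ = trans (cong₂ (λ f i → f i) (Tables.ord≡ t) i≡) ord≡x

      exit : ∀ {u s} → I u s → (vars s iᵛ <ᵇ vars s nᵛ) ≡ false → Q s
      exit {s = s} ([] , k , _ , _ , end , sel) _ = q (subst (SelectedAt M s) (trans (sym (+-identityʳ k)) end) sel)
      exit {s = s} (x ∷ xs , k , _ , _ , end , _ , t , i≡ , _) f = contradiction
        (subst₂ _<_ (sym i≡) (trans end (sym (Input.size≡ (Tables.input t)))) (m<m+n k z<s)) (<ᵇ-false f)

    ∈-decode : ∀ {s lists M} → TablesAt s lists M (lists NS) → ∀ {v} → v ∈ˢ decode s → v ∈ lists NS
    ∈-decode {s} t {v} v∈ = flag≢0 (Tables.outs t) λ eq →
      contradiction (trans (sym (trans (sym (lookup∘tabulate _ v)) ([]=⇒lookup v∈))) (cong (λ k → not (k ≡ᵇ 0)) eq)) λ ()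

    decode-∈ : ∀ {s lists M} → TablesAt s lists M (lists NS) → ∀ {v} → v ∈ lists NS → v ∈ˢ decode s
    decode-∈ {s} t {v} v∈ = lookup⇒[]= v (decode s)
      (trans (lookup∘tabulate _ v) (cong (λ k → not (k ≡ᵇ 0)) (Flags.set (Tables.outs t) v∈)))

    runs-solve : ∀ {s vs} → Down Located vs → (∀ v → v ∈ vs) → length vs ≡ n → MarkedAt s (length vs) →
                 Runs (∑ vs (cost L)) (mark ⨾ select) s (λ s′ → IndependentMinimumDominating G (decode s′))
    runs-solve {s} {vs} located all length≡ m = runs-seq (runs-mark located m
      -- `mark` consumes the visited list from its head and `select` from its other end; reversal
      -- does not change the total cost.
      λ {s₁} (lists , t , i≡ , ns≡ , marking) → subst (λ u → Runs u select s₁ _) (∑-reverse vs (cost L))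
        (runs-select {s₁} (down-reverse located) (trans (length-reverse vs) length≡)
          (lists , subst (TablesAt s₁ lists (lists NM)) (sym ns≡) t , i≡
                 , subst (Selection _ 0) (sym ns≡) (no-selection pos>0))
          λ {s′} (lists′ , t′ , _ , sel) → greedy-optimal clawFree pe pos>0 marking
            (Selection.S⊆M sel) (Selection.indep sel) (λ {v} v∈ → Selection.hit sel v∈ (pos≤n v))
            (decode s′) (∈-decode {s′} t′) (decode-∈ {s′} t′)))
      where
      positions : Positions G {pos} vs
      positions = down-map (λ _ _ → proj₂) located
      pos>0 : ∀ v → 0 < pos v
      pos>0 v = positive G positions (all v)
      pos≤n : ∀ v → pos v ≤ n
      pos≤n v = subst (pos v ≤_) length≡ (position-≤ G positions (all v))

-- The complete program and its linear running time

module _ {n} {G : Graph n} (chordal : Chordal G) (clawFree : ClawFree G) (L : AdjacencyLists G) where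

  runs-program : Runs (searchTime L) program (encode L) (λ s → IndependentMinimumDominating G (decode s))
  runs-program = runs-seq (runs-search L solve)
    where
    solve : ∀ {s} → Searched L s → Runs (searchTime L) (mark ⨾ select) s _
    solve {s} found = runs-weaken le (runs-solve L (arrays s ORD) clawFree pe
        placed complete length≡ ((λ _ → []) , tables , number≡ , refl , no-marking G pe pos≤))
      where
      open Searched found
      open Visited vis
      pos = λ v → arrays s POS (toℕ v)

      positions : Positions G {pos} visited
      positions = down-map (λ _ _ → proj₂) placed

      pe : PerfectElimination G pos
      pe = maxCardinality⇒perfectElimination G chordal maximum distinct positions complete

      length≡ : length visited ≡ n
      length≡ = ≤-antisym (unique-≤ distinct)
        (subst (_≤ length visited) (length-tabulate {n = n} id) (length-⊆ (allFin⁺ n) (λ {v} _ → complete v)))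

      pos≤ : ∀ v → pos v ≤ length visited
      pos≤ v = position-≤ G positions (complete v)

      tables : Tables L (arrays s ORD) (vars s nᵛ) (arrays s) (λ _ → []) [] []
      tables = record
        { input = input ; ord≡ = refl
        ; marks = record { set = λ () ; unset = λ _ → fresh MARK refl _ }
        ; outs = record { set = λ () ; unset = λ _ → fresh OUT refl _ }
        ; counts = λ a a> w → fresh a (late a a>) (toℕ w) }
        where
        late : ∀ a → (MARK <ᵇ a) ≡ true → unusedBySearch a ≡ true
        late (suc (suc (suc (suc (suc (suc (suc (suc (suc (suc _)))))))))) _ = refl

      le : ∑ visited (cost L) ≤ searchTime L
      le = begin
        ∑ visited (cost L)         ≤⟨ ∑-⊆ (cost L) distinct (λ _ → ∈-allFin _) ⟩
        totalCost L                ≤⟨ m≤m+n (totalCost L) (totalCost L) ⟩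
        totalCost L + totalCost L  ≤⟨ m≤m+n _ (n + 0) ⟩
        searchTime L               ∎
        where open ≤-Reasoning

  -- The vertex `v` shows that n is at least 1, which absorbs the additive one. Twice the total cost
  -- is at most 2n + 4m and the initial queue adds another n, whence the constant 4.
  searchTime-linear : Fin n → suc (searchTime L) ≤ 4 * (n + edgeCount G)
  searchTime-linear v = begin
    1 + (totalCost L + totalCost L + (n + 0))  ≤⟨ +-mono-≤ 1≤n (+-monoˡ-≤ (n + 0) (+-mono-≤ total≤ total≤)) ⟩
    n + (n + (e + e) + (n + (e + e)) + (n + 0)) ≡⟨ solve 2 (λ n e → n :+ (n :+ (e :+ e) :+ (n :+ (e :+ e)) :+ (n :+ con 0))
                                                            := con 4 :* (n :+ e)) refl n e ⟩
    4 * (n + e)                                ∎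
    where
    open ≤-Reasoning
    open +-*-Solver
    e = edgeCount G

    1≤n : 1 ≤ n
    1≤n = ≤-trans (s≤s z≤n) (Fin.toℕ<n v)

    total≤ : totalCost L ≤ n + (e + e)
    total≤ = ≤-trans (≤-reflexive (trans (∑-suc (allFin n) (degree L)) (cong (_+ ∑ (allFin n) (degree L)) (length-tabulate {n = n} id))))
                     (+-monoʳ-≤ n (handshake L))

-- The existence of the set is read off a run of the program, for which some adjacency lists have to
-- be supplied.
adjacencyLists : ∀ {n} (G : Graph n) → AdjacencyLists G
adjacencyLists {n} G = record
  { neighbours = λ v → filter (edge? G v) (allFin n)
  ; unique     = λ v → Unique-filter⁺ (edge? G v) (allFin⁺ n)
  ; complete   = λ v w → mk⇔ (λ w∈ → proj₂ (∈-filter⁻ (edge? G v) {xs = allFin n} w∈))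
                             (λ e → ∈-filter⁺ (edge? G v) (∈-allFin w) e) }

runs-ncPathTree : ∀ {n} (G : Graph n) → IsNCPathTree G → (L : AdjacencyLists G) →
                  Runs (searchTime L) program (encode L) (λ s → IndependentMinimumDominating G (decode s))
runs-ncPathTree G (M , nc) = runs-program (pathTree⇒Chordal M) (nonCrossing⇒ClawFree M nc)

theorem5 : (∀ {n : ℕ} (G : Graph n) → Connected G → IsNCPathTree G →
    ∃[ D ] IndependentMinimumDominating G D)
    × FindableInLinearTime (λ G → Connected G × IsNCPathTree G)
    (λ G D → IndependentMinimumDominating G D)
theorem5 =
  (λ G _ nc → _ , Runs.result (runs-ncPathTree G nc (adjacencyLists G))) ,
  program , weight program * 4 ,
  λ { {n} G ((v , _) , nc@(M , cross)) L →
      let open Runs (runs-ncPathTree G nc L)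
          linear = searchTime-linear (pathTree⇒Chordal M) (nonCrossing⇒ClawFree M cross) L v
      in time , final , run
       , ≤-trans bounded (≤-trans (*-monoʳ-≤ (weight program) linear)
                                  (≤-reflexive (sym (*-assoc (weight program) 4 (n + edgeCount G)))))
       , result }
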